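{- Let $p$ be a prime. Then $\mathscr{A}(p)\supset\mathscr{B}(p)$. Moreover, for $(r,e,d)\in\mathscr{B}(p)$, the exponent $g$ in the definition of $\mathscr{A}(p)$ equals $g=2e-(p-1)$, and the constant $\varepsilon_{p,r,e,d}\in\mathbb{F}_p^{\times}$ is given by \[ \varepsilon_{p,r,e,d}=\begin{cases}(-1)^{r-1}\,\varepsilon_{p,r,e,d-1} & \text{if } (r,e,d)\in\mathscr{B}_{+}(p),\\[2pt] (-1)^{\frac{(r+1)(r+2)}{2}+\frac{r(r+1)}{2}e}\,\{r(p-1-e)\}!\,(e!)^{r} & \text{if } (r,e,d)\in\mathscr{B}_{0}(p),\\[2pt] (-1)^{r}\,\varepsilon_{p,r,e,d+1} & \text{if } (r,e,d)\in\mathscr{B}_{ - }(p),\end{cases} \] where the factorials are read in $\mathbb{F}_p$. (If $(r,e,d)\in\mathscr{B}_+(p)$ then $(r,e,d-1)\in\mathscr{B}_0(p)$, and if $(r,e,d)\in\mathscr{B}_-(p)$ then $(r,e,d+1)\in\mathscr{B}_0(p)$.)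
   Context: Let $p$ be a prime and $r\ge 2$. Let $x_1,\dots,x_r$ be independent indeterminates over $\mathbb{F}_p$ and $f(x)=(x-x_1)\cdots(x-x_r)=x^r+s_1x^{r-1}+\cdots+s_r\in\mathbb{F}_p[x_1,\dots,x_r][x]$. For an integer $e\ge 0$ write $f(x)^e=\sum_{i\ge0}c_ix^i$, and for an integer $0\le d\le p$ let $M_d(f(x)^e)$ be the $d\times d$ matrix whose $(i,j)$ entry is $c_{ip+j-d-1}$ ($1\le i,j\le d$). Put $\delta(x_1,\dots,x_r)=\prod_{1\le i<j\le r}(x_i-x_j)$. Define $\mathscr{A}(p)$ as the set of $(r,e,d)\in\mathbb{Z}^3$ with $r\ge2$, $e\ge1$, $1\le d\le p$, such that there exist $\varepsilon_{p,r,e,d}\in\mathbb{F}_p^{\times}$ and a positive integer $g$ with $\det M_d(f(x)^e)=\varepsilon_{p,r,e,d}\,\delta(x_1,\dots,x_r)^g$. Define $\mathscr{B}_+(p)=\{(r,e,d)\in\mathbb{Z}^3: 2\le r\le p,\ e=p-1,\ d=r\}$, $\mathscr{B}_0(p)=\{(r,e,d)\in\mathbb{Z}^3: 2\le r\le p+1,\ (p-1)/2<e\le p-1,\ r(p-1-e)\le p-1,\ d=r-1\}$, $\mathscr{B}_-(p)=\{(r,e,d)\in\mathbb{Z}^3: r\ge2,\ (p-1)/2<e\le p-1,\ r(p-1-e)=p-1,\ d=r-2\}$, and $\mathscr{B}(p)=\mathscr{B}_+(p)\cup\mathscr{B}_0(p)\cup\mathscr{B}_-(p)$. -}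

module Defs where

open import Data.Nat as ℕ using (ℕ; zero; suc; _∸_; _≤_; _<_; _!)
open import Data.Nat.DivMod using (_/_)
open import Data.Nat.Primality using (Prime)
open import Data.Integer as ℤ using (ℤ; +_; -1ℤ)
open import Data.Integer.Divisibility as ℤD using ()
open import Data.Fin using (Fin; zero; suc; toℕ; punchIn)
open import Data.Bool using (if_then_else_)
open import Data.Product using (Σ; _×_)
open import Data.Sum using (_⊎_)
open import Relation.Nullary using (¬_)
open import Relation.Binary.PropositionalEquality using (_≡_)

-- Formal power series with integer coefficients in r commuting
-- variables:  Ser 0 = ℤ,  Ser (suc r) = ℕ → Ser r
-- (the outermost index is the exponent of the first variable).
-- Polynomials are power series with finitely many non-zero
-- coefficients; equality of polynomials over 𝔽_p is coefficientwise
-- congruence mod p (reduction ℤ → 𝔽_p is a ring homomorphism).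

Ser : ℕ → Set
Ser zero    = ℤ
Ser (suc r) = ℕ → Ser r

0S : ∀ {r} → Ser r
0S {zero}  = + 0
0S {suc r} = λ _ → 0S

constS : ∀ {r} → ℤ → Ser r
constS {zero}  c = c
constS {suc r} c = λ { zero → constS c ; (suc _) → 0S }

1S : ∀ {r} → Ser r
1S = constS (+ 1)

infixl 6 _+S_ _-S_
infixl 7 _*S_

_+S_ : ∀ {r} → Ser r → Ser r → Ser r
_+S_ {zero}  a b = a ℤ.+ b
_+S_ {suc r} a b = λ n → a n +S b n

negS : ∀ {r} → Ser r → Ser r
negS {zero}  a = ℤ.- a
negS {suc r} a = λ n → negS (a n)

_-S_ : ∀ {r} → Ser r → Ser r → Ser r
a -S b = a +S negS b

sumRange : ∀ {r} → ℕ → (ℕ → Ser r) → Ser r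
sumRange zero    f = f zero
sumRange (suc n) f = sumRange n f +S f (suc n)

_*S_ : ∀ {r} → Ser r → Ser r → Ser r
_*S_ {zero}  a b = a ℤ.* b
_*S_ {suc r} a b = λ n → sumRange n (λ k → a k *S b (n ∸ k))

_^S_ : ∀ {r} → Ser r → ℕ → Ser r
a ^S zero  = 1S
a ^S suc n = a *S (a ^S n)

varS : ∀ {r} → Fin r → Ser r
varS {suc r} zero    = λ { (suc zero) → 1S ; _ → 0S }
varS {suc r} (suc i) = λ { zero → varS i ; (suc _) → 0S }

sumFin : ∀ {r} (n : ℕ) → (Fin n → Ser r) → Ser r
sumFin zero    f = 0S
sumFin (suc n) f = f zero +S sumFin n (λ i → f (suc i))

prodFin : ∀ {r} (n : ℕ) → (Fin n → Ser r) → Ser r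
prodFin zero    f = 1S
prodFin (suc n) f = f zero *S prodFin n (λ i → f (suc i))

_≈[_]_ : ∀ {r} → Ser r → ℕ → Ser r → Set
_≈[_]_ {zero}  a p b = (+ p) ℤD.∣ (a ℤ.- b)
_≈[_]_ {suc r} a p b = ∀ n → a n ≈[ p ] b n

det : ∀ {r} (n : ℕ) → (Fin n → Fin n → Ser r) → Ser r
det zero    M = 1S
det (suc n) M =
  sumFin (suc n) (λ j →
    constS (-1ℤ ℤ.^ toℕ j) *S M zero j *S det n (λ a b → M (suc a) (punchIn j b)))

-- The objects of the paper.  In Ser (suc r) the first variable is x,
-- the remaining r variables are x₁,…,x_r.

fPoly : (r : ℕ) → Ser (suc r)
fPoly r = prodFin r (λ i → varS zero -S varS (suc i))

coeffFe : (r e k : ℕ) → Ser r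
coeffFe r e k = (fPoly r ^S e) k

-- M_d(f^e): entry (i,j) (1-based) is c_{ip+j-d-1}; with 0-based
-- a = i-1, b = j-1 the index is (a+1)p + b - d  (≥ 0 since d ≤ p).
Mmat : (p r e d : ℕ) → Fin d → Fin d → Ser r
Mmat p r e d a b = coeffFe r e ((suc (toℕ a) ℕ.* p ℕ.+ toℕ b) ∸ d)

delta : (r : ℕ) → Ser r
delta r = prodFin r (λ i → prodFin r (λ j →
  if toℕ i ℕ.<ᵇ toℕ j then varS i -S varS j else 1S))

-- The set 𝒜(p): witnesses ε (an integer, read in 𝔽_p, nonzero mod p)
-- and g ≥ 1 with det M_d(f^e) = ε δ^g in 𝔽_p[x₁,…,x_r].

AWitness : (p r e d : ℕ) → ℤ → ℕ → Set
AWitness p r e d ε g =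
  (2 ≤ r) × (1 ≤ e) × (1 ≤ d) × (d ≤ p) ×
  (¬ ((+ p) ℤD.∣ ε)) × (1 ≤ g) ×
  (det d (Mmat p r e d) ≈[ p ] (constS ε *S (delta r ^S g)))

InA : (p r e d : ℕ) → Set
InA p r e d = Σ ℤ (λ ε → Σ ℕ (λ g → AWitness p r e d ε g))

-- The sets ℬ₊(p), ℬ₀(p), ℬ₋(p).  "(p-1)/2 < e" is written p-1 < 2e.

InB+ : (p r e d : ℕ) → Set
InB+ p r e d = (2 ≤ r) × (r ≤ p) × (e ≡ p ∸ 1) × (d ≡ r)

InB0 : (p r e d : ℕ) → Set
InB0 p r e d = (2 ≤ r) × (r ≤ suc p) × (p ∸ 1 < 2 ℕ.* e) × (e ≤ p ∸ 1)
             × (r ℕ.* (p ∸ 1 ∸ e) ≤ p ∸ 1) × (suc d ≡ r)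

InB- : (p r e d : ℕ) → Set
InB- p r e d = (2 ≤ r) × (p ∸ 1 < 2 ℕ.* e) × (e ≤ p ∸ 1)
             × (r ℕ.* (p ∸ 1 ∸ e) ≡ p ∸ 1) × (d ℕ.+ 2 ≡ r)

InB : (p r e d : ℕ) → Set
InB p r e d = InB+ p r e d ⊎ (InB0 p r e d ⊎ InB- p r e d)

eps0 : (p r e : ℕ) → ℤ
eps0 p r e =
  (-1ℤ ℤ.^ (((suc r ℕ.* suc (suc r)) / 2) ℕ.+ ((r ℕ.* suc r) / 2) ℕ.* e))
  ℤ.* (+ ((r ℕ.* (p ∸ 1 ∸ e)) !))
  ℤ.* ((+ (e !)) ℤ.^ r)

epsB+ : (p r e : ℕ) → ℤ
epsB+ p r e = (-1ℤ ℤ.^ (r ∸ 1)) ℤ.* eps0 p r e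

epsB- : (p r e : ℕ) → ℤ
epsB- p r e = (-1ℤ ℤ.^ r) ℤ.* eps0 p r e

gExp : (p e : ℕ) → ℕ
gExp p e = 2 ℕ.* e ∸ (p ∸ 1)

{-# OPTIONS --safe #-}

-- For f = ∏ (x - x_b) put N(e_1,…,e_r) = det ([x^{ip-1}] x^{r-1-j} ∏ (x - x_b)^{e_b}), 1 ≤ i, j ≤ r-1.
-- The functionals [x^{ip-1}] kill derivatives mod p.  The derivative of
-- (x - x_c)^{e_c} ∏_{b≠c} (x - x_b)^{e_b+1} thus turns into a relation between the
-- columns, and column operations alone give
--   (Σ_b (e_b + 1) - 1) N(e) = ± e_c ∏_{b≠c} (x_c - x_b) N(e with e_c lowered by 1).
-- Lowering one exponent from p-1 to 0 leaves a last row (1,0,…,0) and removes a point, so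
-- N(p-1,…,p-1) = ± δ^{p-1}; lowering all exponents from p-1 to e, with m = p-1-e, gives
--   (rm)! δ^{p-1} = ± (m!)^r δ^{2m} N(e,…,e).
-- Cancel δ^{2m}; by Wilson's theorem m! e! = ± 1.  The cases ℬ₊ and ℬ₋ expand along a last row (1,0,…,0).
module Submission where

open import Defs
open import Algebra.Bundles using (CommutativeRing)
import Algebra.Properties.CommutativeSemiring.Binomial as Binomial
import Algebra.Properties.CommutativeSemiring.Exp as CommutativeExp
import Algebra.Properties.Monoid.Sum as Sum
import Algebra.Properties.Ring as RingProperties
import Algebra.Properties.Semiring.Exp as Exp
import Algebra.Properties.Semiring.Mult as Mult
import Algebra.Solver.Ring as RingSolver
open import Algebra.Solver.Ring.AlmostCommutativeRing using (_-Raw-AlmostCommutative⟶_; fromCommutativeRing)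
open import Algebra.Structures using (IsCommutativeRing)
open import Data.Bool using (if_then_else_)
open import Data.Empty using (⊥-elim)
open import Data.Fin as Fin using (Fin; zero; suc; toℕ; punchIn; inject₁)
import Data.Fin.Properties as Fin
open import Data.Integer as ℤ using (ℤ; +_; -1ℤ)
import Data.Integer.Divisibility as ℤD
import Data.Integer.Divisibility.Signed as ℤS
import Data.Integer.Properties as ℤ
import Data.Integer.Solver
open import Data.List using (List; []; _∷_; _++_; length; map; tabulate)
import Data.List.Properties as List
import Data.Maybe as Maybe
open import Data.Nat as ℕ using (ℕ; zero; suc; z≤n; s≤s; _!; _∸_)
import Data.Nat.Combinatorics as Comb
import Data.Nat.Combinatorics.Specification as Comb
open import Data.Nat.Divisibility as ℕD using (_∣_; divides)
open import Data.Nat.DivMod using (_/_; m*n/n≡m; m/n*n≡m)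
open import Data.Nat.Primality using (Prime; euclidsLemma; prime⇒nonTrivial)
import Data.Nat.Properties as ℕ
import Data.Nat.Solver
open import Data.Product using (_×_; _,_)
open import Data.Sum using (inj₁; inj₂; [_,_]′)
open import Data.Vec using (Vec; []; _∷_; _∷ʳ_; lookup; removeAt)
open import Data.Vec.Relation.Binary.Pointwise.Inductive using (Pointwise; []; _∷_)
open import Data.Vec.Relation.Unary.All using (All; []; _∷_)
open import Data.Vec.Relation.Unary.Any using (Any; here; there)
open import Level using (0ℓ)
open import Relation.Binary.Consequences using (dec⇒weaklyDec)
open import Relation.Binary.PropositionalEquality as ≡ using (_≡_)
open import Relation.Nullary using (¬_; yes; no)

module ℕS = Data.Nat.Solver.+-*-Solver
module ℤR = Data.Integer.Solver.+-*-Solver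

-- Equal exponents are not preserved when a single one is lowered, so the determinant has to be
-- studied for exponents attached to the points one by one. Modulo p an exponent n that lies m steps
-- below p-1 satisfies n+1 = -m. In this coordinate the scalar on the left of the relation is, up to
-- sign, the total number of lowerings made so far, the present one included; the scalar on the
-- right is the number made at the chosen point. Over all steps they multiply to (rm)! and (m!)^r,
-- the origin of the factorials in ε; the bound rm ≤ p-1 makes (rm)! nonzero mod p. Each pair of
-- points contributes its difference from both ends, m times each, whence δ^{2m} and g = p-1-2m =
-- 2e-(p-1). The scalars are carried along as products and never divided out step by step. Only
-- (p-1)!, m! and δ are removed: the factorials by Wilson's theorem, and δ because a difference of
-- distinct variables is not a zero divisor among power series modulo p.

FromIntegers : CommutativeRing 0ℓ 0ℓ → Set
FromIntegers R = ℤ.+-*-rawRing -Raw-AlmostCommutative⟶ fromCommutativeRing R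

-- Integers and signs in a commutative ring.

module IntegerCoefficients (R : CommutativeRing 0ℓ 0ℓ) (ι : FromIntegers R) where
  open CommutativeRing R hiding (zero)
  open Exp semiring using (_^_)
  open RingProperties ring using (-‿involutive; -‿distribˡ-*)
  open import Relation.Binary.Reasoning.Setoid setoid
  open _-Raw-AlmostCommutative⟶_ ι renaming (⟦_⟧ to ⟪_⟫)

  -- The values at 0 and 1 are normalised so that the solver reads con (+ 0)
  -- and con (+ 1) as the constants of R on the nose.
  private
    ⟪_⟫′ : ℤ → Carrier
    ⟪ + 0 ⟫′ = 0#
    ⟪ + 1 ⟫′ = 1#
    ⟪ n ⟫′   = ⟪ n ⟫

    normalised : ∀ n → ⟪ n ⟫′ ≈ ⟪ n ⟫
    normalised (+ 0)                    = sym 0-homo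
    normalised (+ 1)                    = sym 1-homo
    normalised (+ (suc (suc _)))        = refl
    normalised (ℤ.-[1+_] _)             = refl

    ι′ : FromIntegers R
    ι′ = record
      { ⟦_⟧    = ⟪_⟫′
      ; +-homo = λ m n → trans (normalised (m ℤ.+ n)) (trans (+-homo m n) (sym (+-cong (normalised m) (normalised n))))
      ; *-homo = λ m n → trans (normalised (m ℤ.* n)) (trans (*-homo m n) (sym (*-cong (normalised m) (normalised n))))
      ; -‿homo = λ m → trans (normalised (ℤ.- m)) (trans (-‿homo m) (sym (-‿cong (normalised m))))
      ; 0-homo = refl
      ; 1-homo = refl
      }

  open RingSolver ℤ.+-*-rawRing (fromCommutativeRing R) ι′
    (λ m n → Maybe.map (λ m≡n → reflexive (≡.cong ⟪_⟫′ m≡n)) (dec⇒weaklyDec ℤ._≟_ m n))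
    public using (solve; _:=_; _:+_; _:*_; _:-_; :-_; con)

  ν : ℕ → Carrier
  ν n = ⟪ + n ⟫

  ν-+ : ∀ m n → ν (m ℕ.+ n) ≈ ν m + ν n
  ν-+ m n = +-homo (+ m) (+ n)

  ν-* : ∀ m n → ν (m ℕ.* n) ≈ ν m * ν n
  ν-* m n = trans (reflexive (≡.cong ⟪_⟫ (ℤ.pos-* m n))) (*-homo (+ m) (+ n))

  ν-suc : ∀ n → ν (suc n) ≈ 1# + ν n
  ν-suc n = trans (ν-+ 1 n) (+-congʳ 1-homo)

  ν-zero : ν 0 ≈ 0#
  ν-zero = 0-homo

  ν-one : ν 1 ≈ 1#
  ν-one = 1-homo

  sgn : ℕ → Carrier
  sgn zero    = 1#
  sgn (suc n) = - sgn n

  1^ : ∀ n → 1# ^ n ≈ 1#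
  1^ zero    = refl
  1^ (suc n) = trans (*-identityˡ _) (1^ n)

  sgn-+ : ∀ m n → sgn (m ℕ.+ n) ≈ sgn m * sgn n
  sgn-+ zero    n = sym (*-identityˡ _)
  sgn-+ (suc m) n = trans (-‿cong (sgn-+ m n)) (-‿distribˡ-* _ _)

  sgn-^ : ∀ m n → sgn m ^ n ≈ sgn (n ℕ.* m)
  sgn-^ m zero    = refl
  sgn-^ m (suc n) = trans (*-congˡ (sgn-^ m n)) (sym (sgn-+ m (n ℕ.* m)))

  sgn-even : ∀ n → sgn (n ℕ.+ n) ≈ 1#
  sgn-even zero    = refl
  sgn-even (suc n) = trans (-‿cong (reflexive (≡.cong sgn (ℕ.+-suc n n)))) (trans (-‿involutive _) (sgn-even n))

  -- This change of coordinate, from exponents counted upwards to steps counted down from p-1, turns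
  -- the scalars of the lowering relation into factors of factorials.
  ν-complement : ∀ {p′} → ν (suc p′) ≈ 0# → ∀ m n → m ℕ.+ n ≡ p′ → ν (suc n) ≈ - ν m
  ν-complement {p′} char m n m+n≡p′ = begin
    ν (suc n)                   ≈⟨ solve 2 (λ x y → y := :- x :+ (x :+ y)) refl (ν m) (ν (suc n)) ⟩
    - ν m + (ν m + ν (suc n))   ≈⟨ +-congˡ (ν-+ m (suc n)) ⟨
    - ν m + ν (m ℕ.+ suc n)     ≡⟨ ≡.cong (λ i → - ν m + ν i) (≡.trans (ℕ.+-suc m n) (≡.cong suc m+n≡p′)) ⟩
    - ν m + ν (suc p′)          ≈⟨ trans (+-congˡ char) (+-identityʳ _) ⟩
    - ν m ∎

-- The laws of one-variable power series on which the determinant computation rests.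

record SeriesRing (R : CommutativeRing 0ℓ 0ℓ) (ι : FromIntegers R) : Set₁ where
  open CommutativeRing R hiding (zero)
  open _-Raw-AlmostCommutative⟶_ ι renaming (⟦_⟧ to ⟪_⟫)
  infixr 8 _·_
  field
    seriesRing : CommutativeRing 0ℓ 0ℓ
  open CommutativeRing seriesRing public using () renaming
    ( Carrier to 𝔸; _≈_ to _≋_; _+_ to _⊕_; _*_ to _⊗_; -_ to ⊖_; _-_ to _⊝_; 0# to 𝟘; 1# to 𝟙
    ; setoid to 𝔸-setoid; +-cong to ⊕-cong; *-cong to ⊗-cong; -‿cong to ⊖-cong; refl to ≋-refl; sym to ≋-sym; trans to ≋-trans; reflexive to ≋-reflexive)
  field
    C        : Carrier → 𝔸
    C-cong   : ∀ {a b} → a ≈ b → C a ≋ C b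
    C-+      : ∀ a b → C (a + b) ≋ C a ⊕ C b
    C-*      : ∀ a b → C (a * b) ≋ C a ⊗ C b
    C-neg    : ∀ a → C (- a) ≋ ⊖ C a
    C-0      : C 0# ≋ 𝟘
    C-1      : C 1# ≋ 𝟙
    X        : 𝔸
    coef     : ℕ → 𝔸 → Carrier
    coef-cong : ∀ n {f g} → f ≋ g → coef n f ≈ coef n g
    coef-⊕   : ∀ n f g → coef n (f ⊕ g) ≈ coef n f + coef n g
    coef-C   : ∀ n a f → coef n (C a ⊗ f) ≈ a * coef n f
    coef-X-suc  : ∀ n f → coef (suc n) (X ⊗ f) ≈ coef n f
    coef-𝟙-zero : coef 0 𝟙 ≈ 1#
    coef-𝟙-suc  : ∀ n → coef (suc n) 𝟙 ≈ 0#
    D        : 𝔸 → 𝔸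
    D-cong   : ∀ {f g} → f ≋ g → D f ≋ D g
    D-⊕      : ∀ f g → D (f ⊕ g) ≋ D f ⊕ D g
    D-C      : ∀ a f → D (C a ⊗ f) ≋ C a ⊗ D f
    D-X      : ∀ f → D (X ⊗ f) ≋ f ⊕ X ⊗ D f
    D-𝟙      : D 𝟙 ≋ 𝟘
    coef-D   : ∀ n f → coef n (D f) ≈ ⟪ + suc n ⟫ * coef (suc n) f

  _·_ : Carrier → 𝔸 → 𝔸
  a · f = C a ⊗ f

-- Alternating forms and determinants by row expansion.

module Alternation (R : CommutativeRing 0ℓ 0ℓ) (ι : FromIntegers R) (S : SeriesRing R ι) where
  open CommutativeRing R hiding (zero)
  open RingProperties ring using (-0#≈0#)
  open import Relation.Binary.Reasoning.Setoid setoid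
  open IntegerCoefficients R ι
  open SeriesRing S

  record Linear (φ : 𝔸 → Carrier) : Set where
    field
      cong : ∀ {f g} → f ≋ g → φ f ≈ φ g
      add  : ∀ f g → φ (f ⊕ g) ≈ φ f + φ g
      scal : ∀ a f → φ (a · f) ≈ a * φ f

  Form : ℕ → Set
  Form n = Vec 𝔸 n → Carrier

  infixl 10 _▹_
  _▹_ : ∀ {n} → Form (suc n) → 𝔸 → Form n
  (F ▹ f) v = F (f ∷ v)

  HeadLinear : ∀ {n} → Form (suc n) → Set
  HeadLinear F = ∀ v → Linear (λ f → F (f ∷ v))

  -- The conditions follow the recursion on columns: vanishing is asked only for two equal leading
  -- columns, but also of every form obtained by fixing leading columns. Equal columns in other
  -- positions are reached by adjacent swaps, see `repeated-column`.
  data Alternating : ∀ n → Form n → Set where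
    nullary : ∀ {F} → Alternating 0 F
    unary   : ∀ {F} → HeadLinear F → Alternating 1 F
    step    : ∀ {n F} → HeadLinear F → (∀ f → Alternating (suc n) (F ▹ f)) →
              (∀ f v → F (f ∷ f ∷ v) ≈ 0#) → Alternating (suc (suc n)) F

  head-linear : ∀ {n F} → Alternating (suc n) F → HeadLinear F
  head-linear (unary l)    = l
  head-linear (step l _ _) = l

  tail-alternating : ∀ {n F} → Alternating (suc n) F → ∀ f → Alternating n (F ▹ f)
  tail-alternating (unary _)    f = nullary
  tail-alternating (step _ t _) f = t f

  module Head {n} {F : Form (suc n)} (alt : Alternating (suc n) F) {v : Vec 𝔸 n} =
    Linear (head-linear alt v)

  -- Fixing the first column f in `∂ φ F` leaves `φ f * F v - ∂ φ (F ▹ f) v`, which has exactly this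
  -- shape.
  Alternating-combination : ∀ {n F G} c → Alternating n F → Alternating n G →
                            Alternating n (λ v → c * F v - G v)
  Alternating-combination {n} {F} {G} c = go
    where
    linear : ∀ {n} {F G : Form (suc n)} → HeadLinear F → HeadLinear G → HeadLinear (λ v → c * F v - G v)
    linear l m v = record
      { cong = λ f≋g → +-cong (*-congˡ (l.cong f≋g)) (-‿cong (m.cong f≋g))
      ; add  = λ f g → trans (+-cong (*-congˡ (l.add f g)) (-‿cong (m.add f g)))
                 (solve 5 (λ c x y z w → c :* (x :+ y) :- (z :+ w) := (c :* x :- z) :+ (c :* y :- w)) refl _ _ _ _ _)
      ; scal = λ a f → trans (+-cong (*-congˡ (l.scal a f)) (-‿cong (m.scal a f)))
                 (solve 4 (λ c a x z → c :* (a :* x) :- a :* z := a :* (c :* x :- z)) refl _ _ _ _)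
      }
      where
      module l = Linear (l v)
      module m = Linear (m v)
    go : ∀ {n F G} → Alternating n F → Alternating n G → Alternating n (λ v → c * F v - G v)
    go nullary nullary = nullary
    go {F = F} {G} (unary l) (unary m) = unary (linear {F = F} {G} l m)
    go {F = F} {G} (step l t z) (step m u w) = step (linear {F = F} {G} l m) (λ f → go (t f) (u f))
      (λ f v → trans (+-cong (*-congˡ (z f v)) (-‿cong (w f v)))
                 (solve 1 (λ c → c :* con (+ 0) :- con (+ 0) := con (+ 0)) refl c))

  -- Expansion of a determinant along a row φ: the entry of the first column
  -- is split off, the remaining columns are expanded recursively.
  ∂ : ∀ {n} → (𝔸 → Carrier) → Form n → Form (suc n)
  ∂ {zero}  φ F (f ∷ v) = φ f * F v
  ∂ {suc n} φ F (f ∷ v) = φ f * F v - ∂ φ (F ▹ f) v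

  -- The expansion evaluates a form only at subfamilies of the given columns, which inherit P. In
  -- the applications P says that the last row vanishes on a column.
  ∂-local : ∀ {n} {P : 𝔸 → Set} φ {F G : Form n} → (∀ v → All P v → F v ≈ G v) →
            ∀ v → All P v → ∂ φ F v ≈ ∂ φ G v
  ∂-local {zero}  φ F≈G (f ∷ v) (_ ∷ pv)  = *-congˡ (F≈G v pv)
  ∂-local {suc n} φ F≈G (f ∷ v) (pf ∷ pv) =
    +-cong (*-congˡ (F≈G v pv)) (-‿cong (∂-local φ (λ w pw → F≈G (f ∷ w) (pf ∷ pw)) v pv))

  ∂-cong : ∀ {n} φ {F G : Form n} → (∀ v → F v ≈ G v) → ∀ v → ∂ φ F v ≈ ∂ φ G v
  ∂-cong {zero}  φ F≈G (f ∷ v) = *-congˡ (F≈G v)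
  ∂-cong {suc n} φ F≈G (f ∷ v) = +-cong (*-congˡ (F≈G v)) (-‿cong (∂-cong φ (λ w → F≈G (f ∷ w)) v))

  ∂-+ : ∀ {n} φ (F G : Form n) v → ∂ φ (λ w → F w + G w) v ≈ ∂ φ F v + ∂ φ G v
  ∂-+ {zero}  φ F G (f ∷ v) = distribˡ _ _ _
  ∂-+ {suc n} φ F G (f ∷ v) = trans (+-congˡ (-‿cong (∂-+ φ (F ▹ f) (G ▹ f) v)))
    (solve 5 (λ c x y z w → c :* (x :+ y) :- (z :+ w) := (c :* x :- z) :+ (c :* y :- w)) refl _ _ _ _ _)

  ∂-* : ∀ {n} φ a (F : Form n) v → ∂ φ (λ w → a * F w) v ≈ a * ∂ φ F v
  ∂-* {zero}  φ a F (f ∷ v) = solve 3 (λ c a x → c :* (a :* x) := a :* (c :* x)) refl _ _ _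
  ∂-* {suc n} φ a F (f ∷ v) = trans (+-congˡ (-‿cong (∂-* φ a (F ▹ f) v)))
    (solve 4 (λ c a x z → c :* (a :* x) :- a :* z := a :* (c :* x :- z)) refl _ _ _ _)

  ∂-0 : ∀ {n} φ (F : Form n) → (∀ v → F v ≈ 0#) → ∀ v → ∂ φ F v ≈ 0#
  ∂-0 φ F F≈0 v = trans (∂-cong φ (λ w → trans (F≈0 w) (sym (zeroˡ _))) v)
                        (trans (∂-* φ 0# F v) (zeroˡ _))

  ∂-alternating : ∀ {n φ F} → Linear φ → Alternating n F → Alternating (suc n) (∂ φ F)
  ∂-alternating {φ = φ} lin = go
    where
    open Linear lin
    linear : ∀ {n F} → HeadLinear F → HeadLinear (∂ {suc n} φ F)
    linear {F = F} l v = record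
      { cong = λ f≋g → +-cong (*-congʳ (cong f≋g)) (-‿cong (∂-cong φ (λ w → Linear.cong (l w) f≋g) v))
      ; add  = λ f g → trans (+-cong (*-congʳ (add f g))
                 (-‿cong (trans (∂-cong φ (λ w → Linear.add (l w) f g) v) (∂-+ φ (F ▹ f) (F ▹ g) v))))
                 (solve 5 (λ c x y z w → (x :+ y) :* c :- (z :+ w) := (x :* c :- z) :+ (y :* c :- w)) refl _ _ _ _ _)
      ; scal = λ a f → trans (+-cong (*-congʳ (scal a f))
                 (-‿cong (trans (∂-cong φ (λ w → Linear.scal (l w) a f) v) (∂-* φ a (F ▹ f) v))))
                 (solve 4 (λ c a x z → (a :* x) :* c :- a :* z := a :* (x :* c :- z)) refl _ _ _ _)
      }
    go : ∀ {n F} → Alternating n F → Alternating (suc n) (∂ φ F)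
    go {F = F} nullary = unary λ where
      [] → record
        { cong = λ f≋g → *-congʳ (cong f≋g)
        ; add  = λ f g → trans (*-congʳ (add f g)) (distribʳ _ _ _)
        ; scal = λ a f → trans (*-congʳ (scal a f)) (*-assoc _ _ _)
        }
    go {F = F} (unary l) = step (linear l)
      (λ f → Alternating-combination (φ f) (unary l) (go nullary))
      (λ { f [] → -‿inverseʳ _ })
    go {F = F} (step l t z) = step (linear l)
      (λ f → Alternating-combination (φ f) (step l t z) (go (t f)))
      -- The two equal columns contribute the same product with opposite signs; the remaining terms
      -- keep both copies of f in the minor.
      (λ f v → trans (+-congˡ (-‿cong (+-congˡ (-‿cong (∂-0 φ _ (z f) v)))))
         (solve 1 (λ x → x :- (x :- con (+ 0)) := con (+ 0)) refl _))

  Det : ∀ n → (ℕ → 𝔸 → Carrier) → Form n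
  Det zero    φ = λ _ → 1#
  Det (suc n) φ = ∂ (φ 0) (Det n (λ i → φ (suc i)))

  Det-alternating : ∀ n φ → (∀ i → Linear (φ i)) → Alternating n (Det n φ)
  Det-alternating zero    φ lin = nullary
  Det-alternating (suc n) φ lin =
    ∂-alternating (lin 0) (Det-alternating n (λ i → φ (suc i)) (λ i → lin (suc i)))

  -- Polarisation: the form vanishes when `f ⊕ g` is repeated, and in the bilinear expansion the
  -- terms with f twice or g twice vanish too.
  swap : ∀ {n F} → Alternating (suc (suc n)) F → ∀ f g v → F (f ∷ g ∷ v) ≈ - F (g ∷ f ∷ v)
  swap {F = F} alt@(step _ _ dup) f g v = begin
    F (f ∷ g ∷ v)
      ≈⟨ solve 4 (λ x y z w → y := (((x :+ y) :+ (z :+ w)) :- x :- w) :- z) refl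
           (F (f ∷ f ∷ v)) (F (f ∷ g ∷ v)) (F (g ∷ f ∷ v)) (F (g ∷ g ∷ v)) ⟩
    (F (f ∷ f ∷ v) + F (f ∷ g ∷ v) + (F (g ∷ f ∷ v) + F (g ∷ g ∷ v))) - F (f ∷ f ∷ v) - F (g ∷ g ∷ v) - F (g ∷ f ∷ v)
      ≈⟨ +-congʳ (+-cong (+-cong expand (-‿cong (dup f v))) (-‿cong (dup g v))) ⟩
    0# - 0# - 0# - F (g ∷ f ∷ v)
      ≈⟨ solve 1 (λ z → con (+ 0) :- con (+ 0) :- con (+ 0) :- z := :- z) refl _ ⟩
    - F (g ∷ f ∷ v) ∎
    where
    expand : F (f ∷ f ∷ v) + F (f ∷ g ∷ v) + (F (g ∷ f ∷ v) + F (g ∷ g ∷ v)) ≈ 0#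
    expand = trans (sym (trans (Head.add alt f g)
      (+-cong (Head.add (tail-alternating alt f) f g) (Head.add (tail-alternating alt g) f g))))
      (dup (f ⊕ g) v)

  repeated-column : ∀ {n F} → Alternating (suc n) F → ∀ f {v} → Any (f ≋_) v → F (f ∷ v) ≈ 0#
  repeated-column alt@(step _ _ dup) f {g ∷ v} (here f≋g)  =
    trans (Head.cong alt f≋g) (dup g v)
  repeated-column alt@(step _ _ _)   f {g ∷ v} (there f∈v) =
    trans (swap alt f g v) (trans (-‿cong (repeated-column (tail-alternating alt g) f f∈v)) -0#≈0#)

  rotate : ∀ {n F} → Alternating (suc n) F → ∀ f v → F (f ∷ v) ≈ sgn n * F (v ∷ʳ f)
  rotate {zero}  alt f []      = sym (*-identityˡ _)
  rotate {suc n} alt f (g ∷ v) = trans (swap alt f g v)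
    (trans (-‿cong (rotate (tail-alternating alt g) f v))
      (solve 2 (λ s x → :- (s :* x) := :- s :* x) refl _ _))

  Det-zero-column : ∀ n φ f v → (∀ i → φ i f ≈ 0#) → (∀ i → Linear (φ i)) → Det (suc n) φ (f ∷ v) ≈ 0#
  Det-zero-column zero    φ f v φf≈0 lin = trans (*-congʳ (φf≈0 0)) (zeroˡ _)
  Det-zero-column (suc n) φ f v φf≈0 lin = trans
    (+-cong (*-congʳ (φf≈0 0))
      (-‿cong (∂-0 (φ 0) _ (λ w → Det-zero-column n _ f w (λ i → φf≈0 (suc i)) (λ i → lin (suc i))) v)))
    (solve 1 (λ x → con (+ 0) :* x :- con (+ 0) := con (+ 0)) refl _)

  Det-zero-last-row : ∀ n φ v → All (λ f → φ n f ≈ 0#) v → Det (suc n) φ v ≈ 0#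
  Det-zero-last-row zero    φ (f ∷ []) (φf≈0 ∷ []) = trans (*-congʳ φf≈0) (zeroˡ _)
  Det-zero-last-row (suc n) φ v zeros = trans
    (∂-local (φ 0) {G = λ _ → 0#} (Det-zero-last-row n (λ i → φ (suc i))) v zeros)
    (∂-0 (φ 0) (λ _ → 0#) (λ _ → refl) v)

  -- In the expansion along the first row, deleting f leaves a minor with zero last row. Every other
  -- minor keeps f in front, so induction applies to it and one sign is gained.
  Det-last-row : ∀ n φ f v → All (λ g → φ n g ≈ 0#) v →
                 Det (suc n) φ (f ∷ v) ≈ sgn n * (φ n f * Det n φ v)
  Det-last-row zero    φ f [] [] = sym (*-identityˡ _)
  Det-last-row (suc n) φ f v  zeros = begin
    φ 0 f * Det (suc n) φ⁺ v - ∂ (φ 0) (Det (suc n) φ⁺ ▹ f) v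
      ≈⟨ +-cong (*-congˡ (Det-zero-last-row n φ⁺ v zeros)) (-‿cong (begin
           ∂ (φ 0) (Det (suc n) φ⁺ ▹ f) v
             ≈⟨ ∂-local (φ 0) (λ w zw → trans (Det-last-row n φ⁺ f w zw) (sym (*-assoc _ _ _))) v zeros ⟩
           ∂ (φ 0) (λ w → sgn n * φ (suc n) f * Det n φ⁺ w) v
             ≈⟨ ∂-* (φ 0) _ (Det n φ⁺) v ⟩
           sgn n * φ (suc n) f * Det (suc n) φ v ∎)) ⟩
    φ 0 f * 0# - sgn n * φ (suc n) f * Det (suc n) φ v
      ≈⟨ solve 4 (λ a s b x → a :* con (+ 0) :- s :* b :* x := :- s :* (b :* x)) refl _ _ _ _ ⟩
    - sgn n * (φ (suc n) f * Det (suc n) φ v) ∎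
    where
    φ⁺ : ℕ → 𝔸 → Carrier
    φ⁺ i = φ (suc i)

-- Polynomials inside the series ring: degrees, division, derivatives.

module Polynomials (R : CommutativeRing 0ℓ 0ℓ) (ι : FromIntegers R) (S : SeriesRing R ι) where
  open CommutativeRing R hiding (zero)
  open _-Raw-AlmostCommutative⟶_ ι renaming (⟦_⟧ to ⟪_⟫)
  open IntegerCoefficients R ι
  open SeriesRing S
  open Alternation R ι S
  open Exp (CommutativeRing.semiring seriesRing) using () renaming (_^_ to _↑_)
  open import Relation.Binary.Reasoning.Setoid setoid
  module ≋ = CommutativeRing seriesRing

  ι-series : FromIntegers seriesRing
  ι-series = record
    { ⟦_⟧    = λ n → C ⟪ n ⟫
    ; +-homo = λ m n → ≋-trans (C-cong (+-homo m n)) (C-+ _ _)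
    ; *-homo = λ m n → ≋-trans (C-cong (*-homo m n)) (C-* _ _)
    ; -‿homo = λ m → ≋-trans (C-cong (-‿homo m)) (C-neg _)
    ; 0-homo = ≋-trans (C-cong 0-homo) C-0
    ; 1-homo = ≋-trans (C-cong 1-homo) C-1
    }

  open IntegerCoefficients seriesRing ι-series using ()
    renaming (solve to solve₁; _:=_ to _:≋_; _:+_ to _:⊕_; _:*_ to _:⊗_; _:-_ to _:⊝_; :-_ to :⊖_; con to con₁)

  L : Carrier → 𝔸
  L x = X ⊝ C x

  -- A polynomial is certified by peeling off its terms from the top. The leading coefficient c may
  -- be zero, so k is only a degree bound and sums need no case distinction on coefficients that
  -- vanish mod p.
  mutual
    data Below : ℕ → 𝔸 → Set where
      null : ∀ {f} → f ≋ 𝟘 → Below zero f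
      lead : ∀ {k c f} → Leading k c f → Below (suc k) f

    data Leading (k : ℕ) (c : Carrier) (f : 𝔸) : Set where
      rest : ∀ g → Below k g → f ≋ c · X ↑ k ⊕ g → Leading k c f

  Leading-≋ : ∀ {k c f g} → f ≋ g → Leading k c f → Leading k c g
  Leading-≋ f≋g (rest h below f≋) = rest h below (≋-trans (≋-sym f≋g) f≋)

  Leading-≈ : ∀ {k a b f} → a ≈ b → Leading k a f → Leading k b f
  Leading-≈ a≈b (rest h below f≋) = rest h below (≋-trans f≋ (≋.+-congʳ (≋.*-congʳ (C-cong a≈b))))

  Below-⊕ : ∀ {k f g} → Below k f → Below k g → Below k (f ⊕ g)
  Leading-⊕ : ∀ {k a b f g} → Leading k a f → Leading k b g → Leading k (a + b) (f ⊕ g)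
  Below-⊕ (null f≋0) (null g≋0) = null (≋-trans (⊕-cong f≋0 g≋0) (≋.+-identityˡ _))
  Below-⊕ (lead l) (lead m) = lead (Leading-⊕ l m)
  Leading-⊕ {a = a} {b} (rest h p f≋) (rest i q g≋) = rest (h ⊕ i) (Below-⊕ p q)
    (≋-trans (⊕-cong f≋ g≋) (≋-trans
      (solve₁ 5 (λ a b x h i → (a :⊗ x :⊕ h) :⊕ (b :⊗ x :⊕ i) :≋ (a :⊕ b) :⊗ x :⊕ (h :⊕ i)) ≋-refl _ _ _ _ _)
      (≋.+-congʳ (≋.*-congʳ (≋-sym (C-+ a b))))))

  Below-· : ∀ {k} a {f} → Below k f → Below k (a · f)
  Leading-· : ∀ {k} a {c f} → Leading k c f → Leading k (a * c) (a · f)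
  Below-· a (null f≋0) = null (≋-trans (≋.*-congˡ f≋0) (≋.zeroʳ _))
  Below-· a (lead l)   = lead (Leading-· a l)
  Leading-· a {c} (rest h p f≋) = rest (a · h) (Below-· a p)
    (≋-trans (≋.*-congˡ f≋) (≋-trans (≋.distribˡ _ _ _)
      (≋.+-congʳ (≋-trans (≋-sym (≋.*-assoc _ _ _)) (≋.*-congʳ (≋-sym (C-* a c)))))))

  Below-suc : ∀ {k f} → Below k f → Below (suc k) f
  Below-suc below = lead {c = 0#} (rest _ below
    (≋-sym (≋-trans (≋.+-congʳ (≋-trans (≋.*-congʳ C-0) (≋.zeroˡ _))) (≋.+-identityˡ _))))

  Below-X : ∀ {k f} → Below k f → Below (suc k) (X ⊗ f)
  Leading-X : ∀ {k c f} → Leading k c f → Leading (suc k) c (X ⊗ f)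
  Below-X (null f≋0) = Below-suc (null (≋-trans (≋.*-congˡ f≋0) (≋.zeroʳ _)))
  Below-X (lead l) = lead (Leading-X l)
  Leading-X (rest h p f≋) = rest (X ⊗ h) (Below-X p)
    (≋-trans (≋.*-congˡ f≋) (solve₁ 4 (λ x c y h → x :⊗ (c :⊗ y :⊕ h) :≋ c :⊗ (x :⊗ y) :⊕ x :⊗ h) ≋-refl _ _ _ _))

  Leading-⊕-Below : ∀ {k c f g} → Leading k c f → Below k g → Leading k c (f ⊕ g)
  Leading-⊕-Below (rest h p f≋) q = rest (h ⊕ _) (Below-⊕ p q) (≋-trans (≋.+-congʳ f≋) (≋.+-assoc _ _ _))

  L-⊗ : ∀ x f → L x ⊗ f ≋ X ⊗ f ⊕ (- x) · f
  L-⊗ x f = ≋-trans (solve₁ 3 (λ t c f → (t :⊝ c) :⊗ f :≋ t :⊗ f :⊕ (:⊖ c) :⊗ f) ≋-refl _ _ _)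
    (≋.+-congˡ (≋.*-congʳ (≋-sym (C-neg x))))

  Leading-L : ∀ {k} x {c f} → Leading k c f → Leading (suc k) c (L x ⊗ f)
  Leading-L x l = Leading-≋ (≋-sym (L-⊗ x _)) (Leading-⊕-Below (Leading-X l) (lead (Leading-· (- x) l)))

  Leading-C : ∀ c → Leading 0 c (C c)
  Leading-C c = rest 𝟘 (null ≋-refl) (≋-sym (≋-trans (≋.+-identityʳ _) (≋.*-identityʳ _)))

  Leading-𝟙 : Leading 0 1# 𝟙
  Leading-𝟙 = Leading-≋ C-1 (Leading-C 1#)

  coef-X↑ : ∀ k n f → coef (k ℕ.+ n) (X ↑ k ⊗ f) ≈ coef n f
  coef-X↑ zero    n f = coef-cong n (≋.*-identityˡ f)
  coef-X↑ (suc k) n f = trans (coef-cong (suc k ℕ.+ n) (≋.*-assoc _ _ _))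
    (trans (coef-X-suc (k ℕ.+ n) _) (coef-X↑ k n f))

  coef-𝟘 : ∀ n → coef n 𝟘 ≈ 0#
  coef-𝟘 n = trans (coef-cong n (≋-sym (≋.zeroʳ (C 0#)))) (trans (coef-C n 0# 𝟘) (zeroˡ _))

  private
    coef-X↑-𝟙 : ∀ k n → coef (k ℕ.+ n) (X ↑ k) ≈ coef n 𝟙
    coef-X↑-𝟙 k n = trans (coef-cong (k ℕ.+ n) (≋-sym (≋.*-identityʳ _))) (coef-X↑ k n 𝟙)

  coef-Below : ∀ k n {f} → Below k f → coef (k ℕ.+ n) f ≈ 0#
  coef-Below zero    n (null f≋0) = trans (coef-cong n f≋0) (coef-𝟘 n)
  coef-Below (suc k) n {f} (lead {c = c} (rest g below f≋)) = begin
    coef (suc k ℕ.+ n) f                                             ≈⟨ coef-cong (suc k ℕ.+ n) f≋ ⟩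
    coef (suc k ℕ.+ n) (c · X ↑ k ⊕ g)                               ≈⟨ coef-⊕ _ _ _ ⟩
    coef (suc k ℕ.+ n) (c · X ↑ k) + coef (suc k ℕ.+ n) g            ≈⟨ +-congʳ (coef-C _ c _) ⟩
    c * coef (suc k ℕ.+ n) (X ↑ k) + coef (suc k ℕ.+ n) g            ≡⟨ ≡.cong (λ i → c * coef i (X ↑ k) + coef i g) (≡.sym (ℕ.+-suc k n)) ⟩
    c * coef (k ℕ.+ suc n) (X ↑ k) + coef (k ℕ.+ suc n) g            ≈⟨ +-cong (*-congˡ (trans (coef-X↑-𝟙 k (suc n)) (coef-𝟙-suc n))) (coef-Below k (suc n) below) ⟩
    c * 0# + 0#                                                      ≈⟨ trans (+-identityʳ _) (zeroʳ c) ⟩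
    0# ∎

  coef-Leading : ∀ k {c f} → Leading k c f → coef k f ≈ c
  coef-Leading k {c} {f} (rest g below f≋) = begin
    coef k f                                          ≈⟨ coef-cong k f≋ ⟩
    coef k (c · X ↑ k ⊕ g)                            ≈⟨ coef-⊕ k _ _ ⟩
    coef k (c · X ↑ k) + coef k g                     ≈⟨ +-congʳ (coef-C k c _) ⟩
    c * coef k (X ↑ k) + coef k g                     ≡⟨ ≡.cong (λ i → c * coef i (X ↑ k) + coef i g) (≡.sym (ℕ.+-identityʳ k)) ⟩
    c * coef (k ℕ.+ 0) (X ↑ k) + coef (k ℕ.+ 0) g     ≈⟨ +-cong (*-congˡ (trans (coef-X↑-𝟙 k 0) coef-𝟙-zero)) (coef-Below k 0 below) ⟩
    c * 1# + 0#                                       ≈⟨ trans (+-identityʳ _) (*-identityʳ c) ⟩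
    c ∎

  pows : ∀ d → 𝔸 → Vec 𝔸 d
  pows zero    f = []
  pows (suc d) f = X ↑ d ⊗ f ∷ pows d f

  ∈-pows : ∀ {k d} f → k ℕ.< d → Any (X ↑ k ⊗ f ≋_) (pows d f)
  ∈-pows {k} {suc d} f (s≤s k≤d) with k ℕ.≟ d
  ... | yes ≡.refl = here ≋-refl
  ... | no  k≢d    = there (∈-pows f (ℕ.≤∧≢⇒< k≤d k≢d))

  -- The monomials of q below degree n, times f, already stand among `pows n f` and drop out of an
  -- alternating form. For k = n, as in `lower-once`, only the leading coefficient of the multiplier
  -- survives.
  Below-column : ∀ {n F} → Alternating (suc n) F → ∀ k {q} f → Below k q → k ℕ.≤ n →
                 F (q ⊗ f ∷ pows n f) ≈ 0#
  Leading-column : ∀ {n F} → Alternating (suc n) F → ∀ k {c q} f → Leading k c q → k ℕ.≤ n →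
                   F (q ⊗ f ∷ pows n f) ≈ c * F (X ↑ k ⊗ f ∷ pows n f)
  Below-column {n} {F} alt zero f (null q≋0) _ = begin
    F (_ ∷ pows n f)        ≈⟨ Head.cong alt (≋-trans (≋.*-congʳ (≋-trans q≋0 (≋-sym C-0))) ≋-refl) ⟩
    F (0# · f ∷ pows n f)   ≈⟨ Head.scal alt 0# f ⟩
    0# * F (f ∷ pows n f)   ≈⟨ zeroˡ _ ⟩
    0# ∎
  Below-column {n} alt (suc k) f (lead {c = c} l) k<n =
    trans (Leading-column alt k f l (ℕ.<⇒≤ k<n)) (trans (*-congˡ (repeated-column alt _ (∈-pows f k<n))) (zeroʳ c))
  Leading-column {n} {F} alt k {c} {q} f (rest g below q≋) k≤n = begin
    F (q ⊗ f ∷ pows n f)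
      ≈⟨ Head.cong alt (≋-trans (≋.*-congʳ q≋)
           (solve₁ 4 (λ c x g f → (c :⊗ x :⊕ g) :⊗ f :≋ c :⊗ (x :⊗ f) :⊕ g :⊗ f) ≋-refl _ _ _ _)) ⟩
    F (c · (X ↑ k ⊗ f) ⊕ g ⊗ f ∷ pows n f)
      ≈⟨ Head.add alt _ _ ⟩
    F (c · (X ↑ k ⊗ f) ∷ pows n f) + F (g ⊗ f ∷ pows n f)
      ≈⟨ +-cong (Head.scal alt c _) (Below-column alt k f below k≤n) ⟩
    c * F (X ↑ k ⊗ f ∷ pows n f) + 0#
      ≈⟨ +-identityʳ _ ⟩
    c * F (X ↑ k ⊗ f ∷ pows n f) ∎

  -- Since `L x ⊗ f` is X f - x f, a column operation with the neighbour on the right removes the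
  -- factor `L x`, provided the columns further right have been treated before.
  pows-shift : ∀ n {F} x f → Alternating (suc n) F → F (pows n (L x ⊗ f) ∷ʳ f) ≈ F (pows (suc n) f)
  pows-shift zero    x f alt = Head.cong alt (≋-sym (≋.*-identityˡ f))
  pows-shift (suc n) {F} x f alt = begin
    F (X ↑ n ⊗ (L x ⊗ f) ∷ (pows n (L x ⊗ f) ∷ʳ f))
      ≈⟨ pows-shift n x f (tail-alternating alt _) ⟩
    F (X ↑ n ⊗ (L x ⊗ f) ∷ pows (suc n) f)
      ≈⟨ Head.cong alt (≋-trans (≋.*-congˡ (L-⊗ x f))
           (solve₁ 4 (λ y t c f → y :⊗ (t :⊗ f :⊕ c :⊗ f) :≋ (t :⊗ y) :⊗ f :⊕ c :⊗ (y :⊗ f)) ≋-refl _ _ _ _)) ⟩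
    F (X ↑ suc n ⊗ f ⊕ (- x) · (X ↑ n ⊗ f) ∷ pows (suc n) f)
      ≈⟨ Head.add alt _ _ ⟩
    F (X ↑ suc n ⊗ f ∷ pows (suc n) f) + F ((- x) · (X ↑ n ⊗ f) ∷ pows (suc n) f)
      ≈⟨ +-congˡ (trans (Head.scal alt (- x) _) (trans (*-congˡ (repeated-column alt _ (here ≋-refl))) (zeroʳ _))) ⟩
    F (X ↑ suc n ⊗ f ∷ pows (suc n) f) + 0#
      ≈⟨ +-identityʳ _ ⟩
    F (X ↑ suc n ⊗ f ∷ pows (suc n) f) ∎

  -- A point is paired with its exponent.
  Points : Set
  Points = List (Carrier × ℕ)

  -- `Q` raises each exponent of `E` by one. Differentiating `Q ⊗ E` therefore never lowers an
  -- exponent below that of `E`, which remains as a factor.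
  E Q Q′ : Points → 𝔸
  E []             = 𝟙
  E ((y , e) ∷ ys) = L y ↑ e ⊗ E ys

  Q []             = 𝟙
  Q ((y , e) ∷ ys) = L y ⊗ Q ys

  -- Q′ E is the derivative of Q E.
  Q′ []             = 𝟘
  Q′ ((y , e) ∷ ys) = ν (suc e) · Q ys ⊕ L y ⊗ Q′ ys

  -- This is the leading coefficient of `Q′`. In characteristic p a point with exponent p-1
  -- contributes zero to it.
  weight : Points → Carrier
  weight []             = 0#
  weight ((y , e) ∷ ys) = ν (suc e) + weight ys

  cross : Carrier → Points → Carrier
  cross x []             = 1#
  cross x ((y , e) ∷ ys) = (x - y) * cross x ys

  Leading-Q : ∀ ys → Leading (length ys) 1# (Q ys)
  Leading-Q []             = Leading-𝟙
  Leading-Q ((y , e) ∷ ys) = Leading-L y (Leading-Q ys)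

  Leading-Q′ : ∀ y ys → Leading (length ys) (weight (y ∷ ys)) (Q′ (y ∷ ys))
  Leading-Q′ (y , e) [] = Leading-≈ (solve 1 (λ x → x :* con (+ 1) := x :+ con (+ 0)) refl _)
    (Leading-⊕-Below (Leading-· _ Leading-𝟙) (null (≋.zeroʳ _)))
  Leading-Q′ (y , e) (z ∷ ys) = Leading-≈ (+-congʳ (*-identityʳ _))
    (Leading-⊕ (Leading-· _ (Leading-Q (z ∷ ys))) (Leading-L y (Leading-Q′ z ys)))

  module _ (x : Carrier) where
    quot : Points → 𝔸
    quot []             = 𝟘
    quot ((y , e) ∷ ys) = C (cross x ys) ⊕ L y ⊗ quot ys

    -- The remainder on division by X - x is the value at x, namely `cross x ys`. It isolates the
    -- one term of the derivative in which the exponent of x has really dropped.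
    Q-division : ∀ ys → Q ys ≋ C (cross x ys) ⊕ L x ⊗ quot ys
    Q-division [] = ≋-sym (≋-trans (⊕-cong C-1 (≋.zeroʳ _)) (≋.+-identityʳ _))
    Q-division ((y , e) ∷ ys) = ≋-trans (≋.*-congˡ (Q-division ys)) (≋-trans
      (solve₁ 5 (λ t x y q w → (t :⊝ y) :⊗ (q :⊕ (t :⊝ x) :⊗ w) :≋ (x :⊝ y) :⊗ q :⊕ (t :⊝ x) :⊗ (q :⊕ (t :⊝ y) :⊗ w))
        ≋-refl X (C x) (C y) (C (cross x ys)) (quot ys))
      (≋.+-congʳ (≋-sym (≋-trans (C-* _ _) (≋.*-congʳ (≋-trans (C-+ _ _) (≋.+-congˡ (C-neg y))))))))

    Leading-quot : ∀ y ys → Leading (length ys) 1# (quot (y ∷ ys))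
    Leading-quot y [] = Leading-⊕-Below (Leading-C 1#) (null (≋.zeroʳ _))
    Leading-quot (y , e) (z ∷ ys) = Leading-≋ (≋.+-comm _ _)
      (Leading-⊕-Below (Leading-L y (Leading-quot z ys)) (below (length ys)))
      where
      below : ∀ k {c} → Below (suc k) (C c)
      below zero    {c} = lead (Leading-C c)
      below (suc k) = Below-suc (below k)

  D-L : ∀ x f → D (L x ⊗ f) ≋ f ⊕ L x ⊗ D f
  D-L x f = ≋-trans (D-cong (L-⊗ x f)) (≋-trans (D-⊕ _ _) (≋-trans (⊕-cong (D-X f) (D-C (- x) f))
    (≋-trans (≋.+-assoc _ _ _) (≋.+-congˡ (≋-sym (L-⊗ x (D f)))))))

  D-L↑ : ∀ x n f → D (L x ↑ suc n ⊗ f) ≋ ν (suc n) · (L x ↑ n ⊗ f) ⊕ L x ↑ suc n ⊗ D f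
  D-L↑ x zero f = ≋-trans (D-cong (≋.*-congʳ (≋.*-identityʳ _))) (≋-trans (D-L x f)
    (⊕-cong (≋-sym (≋-trans (≋.*-congʳ (≋-trans (C-cong ν-one) C-1)) (≋-trans (≋.*-identityˡ _) (≋.*-identityˡ _))))
      (≋.*-congʳ (≋-sym (≋.*-identityʳ _)))))
  D-L↑ x (suc n) f = ≋-trans (D-cong (≋.*-assoc _ _ _)) (≋-trans (D-L x _)
    (≋-trans (≋.+-congˡ (≋.*-congˡ (D-L↑ x n f))) (≋-trans
      (solve₁ 5 (λ l m c f d → (l :⊗ m) :⊗ f :⊕ l :⊗ (c :⊗ (m :⊗ f) :⊕ (l :⊗ m) :⊗ d)
                  :≋ (con₁ (+ 1) :⊕ c) :⊗ ((l :⊗ m) :⊗ f) :⊕ (l :⊗ (l :⊗ m)) :⊗ d) ≋-refl (L x) (L x ↑ n) (C (ν (suc n))) f (D f))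
      (≋.+-congʳ (≋.*-congʳ (≋-sym (≋-trans (C-cong (ν-suc (suc n))) (≋-trans (C-+ _ _) (≋.+-congʳ C-1)))))))))

  D-QE : ∀ ys → D (Q ys ⊗ E ys) ≋ Q′ ys ⊗ E ys
  D-QE [] = ≋-trans (D-cong (≋.*-identityʳ _)) (≋-trans D-𝟙 (≋-sym (≋.zeroˡ _)))
  D-QE ((y , e) ∷ ys) = ≋-trans
    (D-cong (solve₁ 4 (λ l m q e → (l :⊗ q) :⊗ (m :⊗ e) :≋ (l :⊗ m) :⊗ (q :⊗ e)) ≋-refl (L y) (L y ↑ e) (Q ys) (E ys)))
    (≋-trans (D-L↑ y e _) (≋-trans (≋.+-congˡ (≋.*-congˡ (D-QE ys)))
      (solve₁ 6 (λ l m q e c s → c :⊗ (m :⊗ (q :⊗ e)) :⊕ (l :⊗ m) :⊗ (s :⊗ e) :≋ (c :⊗ q :⊕ l :⊗ s) :⊗ (m :⊗ e))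
         ≋-refl (L y) (L y ↑ e) (Q ys) (E ys) (C (ν (suc e))) (Q′ ys))))

-- Lowering one exponent, and splitting off a trivial last row.

module Determinants (R : CommutativeRing 0ℓ 0ℓ) (ι : FromIntegers R) (S : SeriesRing R ι) (p′ : ℕ)
    (char : CommutativeRing._≈_ R (IntegerCoefficients.ν R ι (suc p′)) (CommutativeRing.0# R)) where
  open CommutativeRing R hiding (zero)
  open IntegerCoefficients R ι
  open SeriesRing S
  open Alternation R ι S
  open Polynomials R ι S
  open Exp semiring using (_^_)
  open Exp ≋.semiring using () renaming (_^_ to _↑_)
  open IntegerCoefficients seriesRing ι-series using ()
    renaming (solve to solve₁; _:=_ to _:≋_; _:+_ to _:⊕_; _:*_ to _:⊗_; :-_ to :⊖_)
  open import Relation.Binary.Reasoning.Setoid setoid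

  -- With rows counted from 0, the index is (i+1)p - 1; the coefficient of a derivative there
  -- carries the factor (i+1)p.
  φ : ℕ → 𝔸 → Carrier
  φ i = coef (p′ ℕ.+ i ℕ.* suc p′)

  φ-linear : ∀ i → Linear (φ i)
  φ-linear i = record { cong = coef-cong _ ; add = coef-⊕ _ ; scal = coef-C _ }

  φ-D : ∀ i f → φ i (D f) ≈ 0#
  φ-D i f = begin
    φ i (D f)                  ≈⟨ coef-D _ f ⟩
    ν (suc i ℕ.* suc p′) * _   ≈⟨ *-congʳ (trans (ν-* (suc i) (suc p′)) (trans (*-congˡ char) (zeroʳ _))) ⟩
    0# * _                     ≈⟨ zeroˡ _ ⟩
    0# ∎

  N : ∀ d → 𝔸 → Carrier
  N d f = Det d φ (pows d f)

  Det-alt : ∀ n → Alternating n (Det n φ)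
  Det-alt n = Det-alternating n φ φ-linear

  Alternating-cong : ∀ {n F v w} → Alternating n F → Pointwise _≋_ v w → F v ≈ F w
  Alternating-cong alt []            = refl
  Alternating-cong alt (f≋g ∷ v≋w) =
    trans (Head.cong alt f≋g) (Alternating-cong (tail-alternating alt _) v≋w)

  pows-cong : ∀ d {f g} → f ≋ g → Pointwise _≋_ (pows d f) (pows d g)
  pows-cong zero    f≋g = []
  pows-cong (suc d) f≋g = ≋.*-congˡ f≋g ∷ pows-cong d f≋g

  N-cong : ∀ d {f g} → f ≋ g → N d f ≈ N d g
  N-cong d f≋g = Alternating-cong (Det-alt d) (pows-cong d f≋g)

  -- The derivative of L x ^ (n+1) Q(ys) E(ys) is a polynomial of degree |ys| times L x ^ n E(ys);
  -- modulo derivatives it therefore relates L x ^ n E(ys) to the columns of N at L x ^ (n+1) E(ys).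
  lower-once : ∀ x n y l → let ys = y ∷ l; d = length ys; f = L x ↑ n ⊗ E ys in
               (ν (suc n) + weight ys) * N d (L x ⊗ f) ≈ sgn d * (ν (suc n) * cross x ys * N d f)
  lower-once x n y l = begin
    (ν (suc n) + weight ys) * F (X ↑ k ⊗ (L x ⊗ f) ∷ cols)
      ≈⟨ Leading-column (Det-alt (suc k)) k (L x ⊗ f) leading ℕ.≤-refl ⟨
    F (w ⊗ (L x ⊗ f) ∷ cols)
      ≈⟨ Head.cong (Det-alt (suc k)) exact ⟩
    F (D s ⊕ (- c) · f ∷ cols)
      ≈⟨ Head.add (Det-alt (suc k)) _ _ ⟩
    F (D s ∷ cols) + F ((- c) · f ∷ cols)
      -- The derivative is a zero column. The column f is moved behind the multiples of `L x ⊗ f`,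
      -- at the cost of k signs; there it lets `pows-shift` strip the factor `L x` from all of them.
      ≈⟨ +-cong (Det-zero-column k φ (D s) cols (λ i → φ-D i s) φ-linear)
           (trans (Head.scal (Det-alt (suc k)) (- c) f) (*-congˡ (rotate (Det-alt (suc k)) f cols))) ⟩
    0# + - c * (sgn k * F (cols ∷ʳ f))
      ≈⟨ +-congˡ (*-congˡ (*-congˡ (pows-shift k x f (Det-alt (suc k))))) ⟩
    0# + - c * (sgn k * N (suc k) f)
      ≈⟨ solve 3 (λ c s z → con (+ 0) :+ (:- c) :* (s :* z) := (:- s) :* (c :* z)) refl _ _ _ ⟩
    sgn (suc k) * (c * N (suc k) f) ∎
    where
    ys = y ∷ l
    k = length l
    f = L x ↑ n ⊗ E ys
    F = Det (suc k) φ
    cols = pows k (L x ⊗ f)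
    s = L x ↑ suc n ⊗ (Q ys ⊗ E ys)
    c = ν (suc n) * cross x ys
    w = ν (suc n) · quot x ys ⊕ Q′ ys

    leading : Leading k (ν (suc n) + weight ys) w
    leading = Leading-≈ (+-congʳ (*-identityʳ _))
      (Leading-⊕ (Leading-· (ν (suc n)) (Leading-quot x y l)) (Leading-Q′ y l))

    exact : w ⊗ (L x ⊗ f) ≋ D s ⊕ (- c) · f
    exact = ≋-sym (≋-trans
      (⊕-cong
        (≋-trans (D-L↑ x n _) (⊕-cong (≋.*-congˡ (≋.*-congˡ (≋.*-congʳ (Q-division x ys)))) (≋.*-congˡ (D-QE ys))))
        (≋.*-congʳ (≋-trans (C-neg c) (⊖-cong (C-* _ _)))))
      (solve₁ 7 (λ c q l w m e t →
         (c :⊗ (m :⊗ ((q :⊕ l :⊗ w) :⊗ e)) :⊕ (l :⊗ m) :⊗ (t :⊗ e)) :⊕ (:⊖ (c :⊗ q)) :⊗ (m :⊗ e)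
           :≋ (c :⊗ w :⊕ t) :⊗ (l :⊗ (m :⊗ e))) ≋-refl
         (C (ν (suc n))) (C (cross x ys)) (L x) (quot x ys) (L x ↑ n) (E ys) (Q′ ys)))

  -- This is (a+k)!/a!, the product of the left-hand scalars over k lowerings preceded by a others.
  rise : ℕ → ℕ → ℕ
  rise a zero    = 1
  rise a (suc k) = (suc k ℕ.+ a) ℕ.* rise a k

  rise-+ : ∀ a m n → rise a (m ℕ.+ n) ≡ rise a n ℕ.* rise (n ℕ.+ a) m
  rise-+ a zero    n = ≡.sym (ℕ.*-identityʳ _)
  rise-+ a (suc m) n = ≡.trans
    (≡.cong₂ ℕ._*_ (ℕ.+-assoc (suc m) n a) (rise-+ a m n)) (x∙yz≈y∙xz (suc m ℕ.+ (n ℕ.+ a)) (rise a n) _)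
    where open import Algebra.Properties.CommutativeSemigroup ℕ.*-commutativeSemigroup using (x∙yz≈y∙xz)

  rise-zero : ∀ k → rise 0 k ≡ k !
  rise-zero zero    = ≡.refl
  rise-zero (suc k) = ≡.cong₂ ℕ._*_ (ℕ.+-identityʳ (suc k)) (rise-zero k)

  -- The number a counts the lowerings already made at the other points. By `ν-complement` the step
  -- from m to m+1 has the scalars -(m+1+a) on the left and -(m+1) on the right, and the two minus
  -- signs cancel.
  lower : ∀ x y l a → let ys = y ∷ l; d = length ys in weight ys ≈ - ν a → ∀ m n → m ℕ.+ n ≡ p′ →
          ν (rise a m) * N d (L x ↑ p′ ⊗ E ys) ≈ ν (m !) * ((sgn d * cross x ys) ^ m * N d (L x ↑ n ⊗ E ys))
  lower x y l a weight≈ zero    n ≡.refl = *-congˡ (sym (*-identityˡ _))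
  lower x y l a weight≈ (suc m) n m+n≡p′ = begin
    ν (rise a (suc m)) * N₀
      ≈⟨ *-congʳ (ν-* (suc m ℕ.+ a) (rise a m)) ⟩
    ν (suc m ℕ.+ a) * ν (rise a m) * N₀
      ≈⟨ trans (*-assoc _ _ _) (*-congˡ (lower x y l a weight≈ m (suc n) (≡.trans (ℕ.+-suc m n) m+n≡p′))) ⟩
    ν (suc m ℕ.+ a) * (ν (m !) * (u ^ m * N d (L x ↑ suc n ⊗ E ys)))
      ≈⟨ solve 4 (λ a b c x → a :* (b :* (c :* x)) := b :* (c :* (a :* x))) refl _ _ _ _ ⟩
    ν (m !) * (u ^ m * (ν (suc m ℕ.+ a) * N d (L x ↑ suc n ⊗ E ys)))
      ≈⟨ *-congˡ (*-congˡ once) ⟩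
    ν (m !) * (u ^ m * (ν (suc m) * (u * N d (L x ↑ n ⊗ E ys))))
      ≈⟨ solve 5 (λ a b c u x → b :* (c :* (a :* (u :* x))) := (a :* b) :* ((u :* c) :* x)) refl _ _ _ _ _ ⟩
    ν (suc m) * ν (m !) * (u ^ suc m * N d (L x ↑ n ⊗ E ys))
      ≈⟨ *-congʳ (ν-* (suc m) (m !)) ⟨
    ν (suc m !) * (u ^ suc m * N d (L x ↑ n ⊗ E ys)) ∎
    where
    ys = y ∷ l
    d = length ys
    u = sgn d * cross x ys
    N₀ = N d (L x ↑ p′ ⊗ E ys)
    once : ν (suc m ℕ.+ a) * N d (L x ↑ suc n ⊗ E ys) ≈ ν (suc m) * (u * N d (L x ↑ n ⊗ E ys))
    once = begin
      ν (suc m ℕ.+ a) * N d (L x ↑ suc n ⊗ E ys)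
        ≈⟨ *-cong (ν-+ (suc m) a) (N-cong d (≋.*-assoc _ _ _)) ⟩
      (ν (suc m) + ν a) * N d (L x ⊗ (L x ↑ n ⊗ E ys))
        ≈⟨ solve 3 (λ x y z → (x :+ y) :* z := :- ((:- x :- y) :* z)) refl _ _ _ ⟩
      - ((- ν (suc m) - ν a) * N d (L x ⊗ (L x ↑ n ⊗ E ys)))
        ≈⟨ -‿cong (*-congʳ (+-cong (ν-complement char (suc m) n m+n≡p′) weight≈)) ⟨
      - ((ν (suc n) + weight ys) * N d (L x ⊗ (L x ↑ n ⊗ E ys)))
        ≈⟨ -‿cong (lower-once x n y l) ⟩
      - (sgn d * (ν (suc n) * cross x ys * N d (L x ↑ n ⊗ E ys)))
        ≈⟨ -‿cong (*-congˡ (*-congʳ (*-congʳ (ν-complement char (suc m) n m+n≡p′)))) ⟩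
      - (sgn d * (- ν (suc m) * cross x ys * N d (L x ↑ n ⊗ E ys)))
        ≈⟨ solve 4 (λ s a c x → :- (s :* (:- a :* c :* x)) := a :* ((s :* c) :* x)) refl _ _ _ _ ⟩
      ν (suc m) * (u * N d (L x ↑ n ⊗ E ys)) ∎

  -- The last row reads the coefficient of index k + (k+1)(p-1). For the first column this is the
  -- leading coefficient, and it lies above the degree of all other columns. Both the removal of a
  -- point and the passage between the three families rest on this.
  peel : ∀ k {f} → Leading (suc k ℕ.* p′) 1# f → N (suc k) f ≈ sgn k * N k f
  peel k {f} leading = begin
    N (suc k) f                                 ≈⟨ Det-last-row k φ _ _ (zeros k ℕ.≤-refl) ⟩
    sgn k * (φ k (X ↑ k ⊗ f) * N k f)           ≈⟨ *-congˡ (trans (*-congʳ top) (*-identityˡ _)) ⟩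
    sgn k * N k f ∎
    where
    index : p′ ℕ.+ k ℕ.* suc p′ ≡ k ℕ.+ suc k ℕ.* p′
    index = ℕS.solve 2 (λ p k → p ℕS.:+ k ℕS.:* (ℕS.con 1 ℕS.:+ p) ℕS.:= k ℕS.:+ (p ℕS.:+ k ℕS.:* p)) ≡.refl p′ k
    top : φ k (X ↑ k ⊗ f) ≈ 1#
    top = trans (reflexive (≡.cong (λ i → coef i (X ↑ k ⊗ f)) index)) (trans (coef-X↑ k _ f) (coef-Leading _ leading))
    zeros : ∀ j → j ℕ.≤ k → All (λ g → φ k g ≈ 0#) (pows j f)
    zeros zero    _   = []
    zeros (suc j) j<k = zero′ ∷ zeros j (ℕ.<⇒≤ j<k)
      where
      i = k ℕ.∸ suc j
      index′ : p′ ℕ.+ k ℕ.* suc p′ ≡ j ℕ.+ (suc (suc k ℕ.* p′) ℕ.+ i)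
      index′ = ≡.trans index (≡.trans (≡.cong (ℕ._+ suc k ℕ.* p′) (≡.sym (ℕ.m+[n∸m]≡n j<k)))
        (ℕS.solve 3 (λ j i q → (ℕS.con 1 ℕS.:+ j ℕS.:+ i) ℕS.:+ q ℕS.:= j ℕS.:+ (ℕS.con 1 ℕS.:+ q ℕS.:+ i)) ≡.refl j i (suc k ℕ.* p′)))
      zero′ : φ k (X ↑ j ⊗ f) ≈ 0#
      zero′ = trans (reflexive (≡.cong (λ i → coef i (X ↑ j ⊗ f)) index′))
        (trans (coef-X↑ j _ f) (coef-Below _ i (lead leading)))

-- The index is chosen so that `tri n` is n(n-1)/2, the number of pairs among n points.
tri : ℕ → ℕ
tri zero    = 0
tri (suc n) = n ℕ.+ tri n

-- Evaluation of the determinant at equal exponents.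

module Exponents (R : CommutativeRing 0ℓ 0ℓ) (ι : FromIntegers R) (S : SeriesRing R ι) (p′ : ℕ)
    (char : CommutativeRing._≈_ R (IntegerCoefficients.ν R ι (suc p′)) (CommutativeRing.0# R)) where
  open CommutativeRing R hiding (zero)
  open IntegerCoefficients R ι
  open SeriesRing S
  open Alternation R ι S
  open Polynomials R ι S
  open Determinants R ι S p′ char
  open Exp semiring using (_^_; ^-congˡ; ^-homo-*; ^-assocʳ)
  open CommutativeExp commutativeSemiring using (^-distrib-*)
  open Exp ≋.semiring using () renaming (_^_ to _↑_)
  open IntegerCoefficients seriesRing ι-series using () renaming (solve to solve₁; _:=_ to _:≋_; _:*_ to _:⊗_)
  open import Relation.Binary.Reasoning.Setoid setoid

  at : ℕ → List Carrier → Points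
  at e = map (_, e)

  diffs : Carrier → List Carrier → Carrier
  diffs x []       = 1#
  diffs x (y ∷ ys) = (x - y) * diffs x ys

  vandermonde : List Carrier → Carrier
  vandermonde []       = 1#
  vandermonde (x ∷ xs) = diffs x xs * vandermonde xs

  cross-at : ∀ x e ys → cross x (at e ys) ≈ diffs x ys
  cross-at x e []       = refl
  cross-at x e (y ∷ ys) = *-congˡ (cross-at x e ys)

  cross-++ : ∀ x ys zs → cross x (ys ++ zs) ≈ cross x ys * cross x zs
  cross-++ x []             zs = sym (*-identityˡ _)
  cross-++ x ((y , e) ∷ ys) zs = trans (*-congˡ (cross-++ x ys zs)) (sym (*-assoc _ _ _))

  E-insert : ∀ ys z zs → E (ys ++ z ∷ zs) ≋ E (z ∷ ys ++ zs)
  E-insert []             z zs = ≋-refl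
  E-insert ((y , e) ∷ ys) (z , f) zs = ≋-trans (≋.*-congˡ (E-insert ys (z , f) zs))
    (solve₁ 3 (λ x y z → x :⊗ (y :⊗ z) :≋ y :⊗ (x :⊗ z)) ≋-refl _ _ _)

  weight-at : ∀ m e → m ℕ.+ e ≡ p′ → ∀ xs zs a → weight zs ≈ - ν a →
              weight (at e xs ++ zs) ≈ - ν (length xs ℕ.* m ℕ.+ a)
  weight-at m e eq []       zs a w = w
  weight-at m e eq (x ∷ xs) zs a w = begin
    ν (suc e) + weight (at e xs ++ zs)                  ≈⟨ +-cong (ν-complement char m e eq) (weight-at m e eq xs zs a w) ⟩
    - ν m + - ν (length xs ℕ.* m ℕ.+ a)                 ≈⟨ solve 2 (λ x y → :- x :+ :- y := :- (x :+ y)) refl _ _ ⟩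
    - (ν m + ν (length xs ℕ.* m ℕ.+ a))                 ≈⟨ -‿cong (ν-+ m _) ⟨
    - ν (m ℕ.+ (length xs ℕ.* m ℕ.+ a))                 ≡⟨ ≡.cong (λ i → - ν i) (≡.sym (ℕ.+-assoc m _ a)) ⟩
    - ν (m ℕ.+ length xs ℕ.* m ℕ.+ a) ∎

  weight-top : ∀ xs → weight (at p′ xs) ≈ - ν 0
  weight-top []       = trans (solve 0 (con (+ 0) := :- con (+ 0)) refl) (-‿cong (sym ν-zero))
  weight-top (x ∷ xs) = trans (+-cong char (weight-top xs)) (+-identityˡ _)

  -- Here the size of the determinant is a fixed `suc k` and the list need not be visibly a cons, as
  -- is the case for concatenations.
  lower′ : ∀ k zs → length zs ≡ suc k → ∀ x a → weight zs ≈ - ν a → ∀ m n → m ℕ.+ n ≡ p′ →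
           ν (rise a m) * N (suc k) (E ((x , p′) ∷ zs)) ≈
           ν (m !) * ((sgn (suc k) * cross x zs) ^ m * N (suc k) (E ((x , n) ∷ zs)))
  lower′ k (z ∷ zs) ≡.refl x a = lower x z zs a

  module Chain (m e : ℕ) (m+e≡p′ : m ℕ.+ e ≡ p′) (k : ℕ) where

    d : ℕ
    d = suc k

    -- The squared factors collected while the exponents of ys are lowered from p′ to e,
    -- those of xs having been lowered before.
    factor : List Carrier → List Carrier → Carrier
    factor []       xs = 1#
    factor (y ∷ ys) xs = (sgn d * (diffs y xs * diffs y ys)) * factor ys (y ∷ xs)

    -- Each point of xs has weight -m and each point of ys weight 0. The rise for the next point
    -- thus begins where the previous one ended, and the rises telescope; starting from empty xs
    -- they give (rm)!.
    lower-all : ∀ ys xs → length xs ℕ.+ length ys ≡ suc d →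
      ν (rise (length xs ℕ.* m) (length ys ℕ.* m)) * N d (E (at e xs ++ at p′ ys)) ≈
      (ν (m !) ^ length ys * factor ys xs ^ m) * N d (E (at e xs ++ at e ys))
    lower-all []       xs _  = trans (*-congʳ ν-one) (*-congʳ (sym (trans (*-identityˡ _) (1^ m))))
    lower-all (y ∷ ys) xs eq = begin
      ν (rise a (m ℕ.+ l)) * N d (E (at e xs ++ at p′ (y ∷ ys)))
        ≈⟨ *-cong (trans (reflexive (≡.cong ν (≡.trans (≡.cong (rise a) (ℕ.+-comm m l)) (rise-+ a l m)))) (ν-* (rise a m) _))
             (N-cong d (E-insert (at e xs) (y , p′) (at p′ ys))) ⟩
      ν (rise a m) * ν (rise (m ℕ.+ a) l) * N d (E ((y , p′) ∷ at e xs ++ at p′ ys))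
        ≈⟨ solve 3 (λ x y z → x :* y :* z := y :* (x :* z)) refl _ _ _ ⟩
      ν (rise (m ℕ.+ a) l) * (ν (rise a m) * N d (E ((y , p′) ∷ at e xs ++ at p′ ys)))
        ≈⟨ *-congˡ (lower′ k (at e xs ++ at p′ ys) len y a weight≈ m e m+e≡p′) ⟩
      ν (rise (m ℕ.+ a) l) * (ν (m !) * (u ^ m * N d (E (at e (y ∷ xs) ++ at p′ ys))))
        ≈⟨ solve 4 (λ a b c x → a :* (b :* (c :* x)) := b :* (c :* (a :* x))) refl _ _ _ _ ⟩
      ν (m !) * (u ^ m * (ν (rise (m ℕ.+ a) l) * N d (E (at e (y ∷ xs) ++ at p′ ys))))
        ≈⟨ *-congˡ (*-congˡ (lower-all ys (y ∷ xs) (≡.trans (≡.sym (ℕ.+-suc _ _)) eq))) ⟩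
      ν (m !) * (u ^ m * ((ν (m !) ^ length ys * factor ys (y ∷ xs) ^ m) * N d (E (at e (y ∷ xs) ++ at e ys))))
        ≈⟨ solve 5 (λ a b c d x → a :* (b :* ((c :* d) :* x)) := ((a :* c) :* (b :* d)) :* x) refl _ _ _ _ _ ⟩
      ν (m !) ^ length (y ∷ ys) * (u ^ m * factor ys (y ∷ xs) ^ m) * N d (E (at e (y ∷ xs) ++ at e ys))
        ≈⟨ *-cong (*-congˡ (trans (sym (^-distrib-* u _ m)) (^-congˡ m (*-congʳ (*-congˡ
             (trans (cross-++ y (at e xs) _) (*-cong (cross-at y e xs) (cross-at y p′ ys))))))))
             (N-cong d (≋-sym (E-insert (at e xs) (y , e) (at e ys)))) ⟩
      ν (m !) ^ length (y ∷ ys) * factor (y ∷ ys) xs ^ m * N d (E (at e xs ++ at e (y ∷ ys))) ∎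
      where
      a = length xs ℕ.* m
      l = length ys ℕ.* m
      u = sgn d * cross y (at e xs ++ at p′ ys)
      len : length (at e xs ++ at p′ ys) ≡ suc k
      len = ≡.trans (List.length-++ (at e xs)) (≡.trans
        (≡.cong₂ ℕ._+_ (List.length-map (_, e) xs) (List.length-map (_, p′) ys))
        (ℕ.suc-injective (≡.trans (≡.sym (ℕ.+-suc _ _)) eq)))
      weight≈ : weight (at e xs ++ at p′ ys) ≈ - ν a
      weight≈ = trans (weight-at m e m+e≡p′ xs (at p′ ys) 0 (weight-top ys))
        (reflexive (≡.cong (λ i → - ν i) (ℕ.+-identityʳ a)))

    diffs² : List Carrier → List Carrier → Carrier
    diffs² []       xs = 1#
    diffs² (y ∷ ys) xs = diffs y xs * diffs² ys xs

    -- When y joins the lowered points, its difference with each remaining point is read in the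
    -- opposite direction.
    diffs²-∷ : ∀ ys y xs → diffs² ys (y ∷ xs) ≈ sgn (length ys) * (diffs y ys * diffs² ys xs)
    diffs²-∷ []       y xs = sym (trans (*-identityˡ _) (*-identityˡ _))
    diffs²-∷ (z ∷ ys) y xs = trans (*-congˡ (diffs²-∷ ys y xs))
      (solve 6 (λ y z a s b c → ((z :- y) :* a) :* (s :* (b :* c)) := (:- s) :* (((y :- z) :* b) :* (a :* c)))
        refl y z _ _ _ _)

    -- A pair inside ys is met once from each end, in opposite orientations: this gives the squared
    -- Vandermonde product and one sign per pair, counted by `tri`. The factor `sgn d` enters once
    -- per point.
    factor-closed : ∀ ys xs → factor ys xs ≈
      sgn (length ys ℕ.* d) * sgn (tri (length ys)) * ((vandermonde ys * vandermonde ys) * diffs² ys xs)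
    factor-closed []       xs = solve 0 (con (+ 1) := con (+ 1) :* con (+ 1) :* ((con (+ 1) :* con (+ 1)) :* con (+ 1))) refl
    factor-closed (y ∷ ys) xs = begin
      sgn d * (diffs y xs * diffs y ys) * factor ys (y ∷ xs)
        ≈⟨ *-congˡ (trans (factor-closed ys (y ∷ xs)) (*-congˡ (*-congˡ (diffs²-∷ ys y xs)))) ⟩
      sgn d * (diffs y xs * diffs y ys) *
        (sgn (length ys ℕ.* d) * sgn (tri (length ys)) *
          ((vandermonde ys * vandermonde ys) * (sgn (length ys) * (diffs y ys * diffs² ys xs))))
        ≈⟨ solve 8 (λ s a b t u v w c → s :* (a :* b) :* (t :* u :* ((v :* v) :* (w :* (b :* c))))
             := (s :* t) :* (w :* u) :* (((b :* v) :* (b :* v)) :* (a :* c))) refl _ _ _ _ _ _ _ _ ⟩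
      (sgn d * sgn (length ys ℕ.* d)) * (sgn (length ys) * sgn (tri (length ys))) *
        (vandermonde (y ∷ ys) * vandermonde (y ∷ ys) * diffs² (y ∷ ys) xs)
        ≈⟨ *-congʳ (*-cong (sgn-+ d _) (sgn-+ (length ys) _)) ⟨
      sgn (length (y ∷ ys) ℕ.* d) * sgn (tri (length (y ∷ ys))) *
        (vandermonde (y ∷ ys) * vandermonde (y ∷ ys) * diffs² (y ∷ ys) xs) ∎

    diffs²-[] : ∀ ys → diffs² ys [] ≈ 1#
    diffs²-[] []       = refl
    diffs²-[] (y ∷ ys) = trans (*-identityˡ _) (diffs²-[] ys)

    factor-total : ∀ zs → length zs ≡ suc d → factor zs [] ≈ sgn (tri (suc d)) * (vandermonde zs * vandermonde zs)
    factor-total zs len = begin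
      factor zs []
        ≈⟨ trans (factor-closed zs []) (*-congˡ (trans (*-congˡ (diffs²-[] zs)) (*-identityʳ _))) ⟩
      sgn (length zs ℕ.* d) * sgn (tri (length zs)) * (V * V)
        ≡⟨ ≡.cong (λ i → sgn (i ℕ.* d) * sgn (tri i) * (V * V)) len ⟩
      sgn (suc d ℕ.* d) * sgn (tri (suc d)) * (V * V)
        -- The d+1 factors `sgn d` cancel because d(d+1) is even.
        ≈⟨ *-congʳ (trans (*-congʳ (sgn-consecutive d)) (*-identityˡ _)) ⟩
      sgn (tri (suc d)) * (V * V) ∎
      where
      V = vandermonde zs
      sgn-consecutive : ∀ n → sgn (suc n ℕ.* n) ≈ 1#
      sgn-consecutive zero    = refl
      sgn-consecutive (suc n) = trans
        (reflexive (≡.cong sgn (ℕS.solve 1 (λ n → (ℕS.con 2 ℕS.:+ n) ℕS.:* (ℕS.con 1 ℕS.:+ n)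
          ℕS.:= ((ℕS.con 1 ℕS.:+ n) ℕS.:+ (ℕS.con 1 ℕS.:+ n)) ℕS.:+ (ℕS.con 1 ℕS.:+ n) ℕS.:* n) ≡.refl n)))
        (trans (sgn-+ (suc n ℕ.+ suc n) _) (trans (*-cong (sgn-even (suc n)) (sgn-consecutive n)) (*-identityˡ _)))

    descent : ∀ zs → length zs ≡ suc d →
      ν ((suc d ℕ.* m) !) * N d (E (at p′ zs)) ≈
      ν (m !) ^ suc d * (sgn (tri (suc d)) * (vandermonde zs * vandermonde zs)) ^ m * N d (E (at e zs))
    descent zs len = begin
      ν ((suc d ℕ.* m) !) * N d (E (at p′ zs))
        ≡⟨ ≡.cong (λ i → ν i * N d (E (at p′ zs))) (≡.trans (≡.sym (rise-zero (suc d ℕ.* m))) (≡.cong (λ i → rise 0 (i ℕ.* m)) (≡.sym len))) ⟩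
      ν (rise 0 (length zs ℕ.* m)) * N d (E (at p′ zs))
        ≈⟨ lower-all zs [] len ⟩
      ν (m !) ^ length zs * factor zs [] ^ m * N d (E (at e zs))
        ≈⟨ *-congʳ (*-cong (reflexive (≡.cong (ν (m !) ^_) len)) (^-congˡ m (factor-total zs len))) ⟩
      ν (m !) ^ suc d * (sgn (tri (suc d)) * (vandermonde zs * vandermonde zs)) ^ m * N d (E (at e zs)) ∎

  Leading-E : ∀ e xs → Leading (length xs ℕ.* e) 1# (E (at e xs))
  Leading-E e []       = Leading-𝟙
  Leading-E e (x ∷ xs) = times e
    where
    times : ∀ n → Leading (n ℕ.+ length xs ℕ.* e) 1# (L x ↑ n ⊗ E (at e xs))
    times zero    = Leading-≋ (≋-sym (≋.*-identityˡ _)) (Leading-E e xs)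
    times (suc n) = Leading-≋ (≋-sym (≋.*-assoc _ _ _)) (Leading-L x (times n))

  module Top (w : Carrier) (w-inverse : w * ν (p′ !) ≈ 1#) (sgn-p′ : sgn p′ ≈ 1#) where

    -- The other points have weight 0, so lowering x down to exponent 0 produces the same scalar
    -- (p-1)! on both sides, to be cancelled by w. The polynomial left over is monic of the degree
    -- that `peel` requires.
    top : ∀ d zs → length zs ≡ suc d → N d (E (at p′ zs)) ≈ sgn (tri d) * vandermonde zs ^ p′
    top zero    (z ∷ [])     len = sym (trans (*-identityˡ _)
      (trans (^-congˡ p′ (*-identityˡ _)) (1^ p′)))
    top (suc k) (x ∷ zs) len = begin
      N d (E (at p′ (x ∷ zs)))
        ≈⟨ cancel ⟩
      (sgn d * cross x (at p′ zs)) ^ p′ * N d (𝟙 ⊗ E (at p′ zs))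
        ≈⟨ *-cong (trans (^-distrib-* (sgn d) _ p′) (*-cong sign (^-congˡ p′ (cross-at x p′ zs)))) (N-cong d (≋.*-identityˡ _)) ⟩
      1# * diffs x zs ^ p′ * N d (E (at p′ zs))
        ≈⟨ *-congˡ (trans (peel k leading) (*-congˡ (top k zs len′))) ⟩
      1# * diffs x zs ^ p′ * (sgn k * (sgn (tri k) * vandermonde zs ^ p′))
        ≈⟨ solve 4 (λ a b c e → con (+ 1) :* a :* (b :* (c :* e)) := (b :* c) :* (a :* e)) refl _ _ _ _ ⟩
      sgn k * sgn (tri k) * (diffs x zs ^ p′ * vandermonde zs ^ p′)
        ≈⟨ *-cong (sgn-+ k (tri k)) (^-distrib-* _ _ p′) ⟨
      sgn (tri d) * vandermonde (x ∷ zs) ^ p′ ∎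
      where
      d = suc k
      len′ : length zs ≡ suc k
      len′ = ℕ.suc-injective len
      leading : Leading (suc k ℕ.* p′) 1# (E (at p′ zs))
      leading = ≡.subst (λ i → Leading (i ℕ.* p′) 1# (E (at p′ zs))) len′ (Leading-E p′ zs)
      sign : sgn d ^ p′ ≈ 1#
      sign = trans (sgn-^ d p′) (trans (reflexive (≡.cong sgn (ℕ.*-comm p′ d)))
        (trans (sym (sgn-^ p′ d)) (trans (^-congˡ d sgn-p′) (1^ d))))
      lowered : ν (p′ !) * N d (E (at p′ (x ∷ zs))) ≈
                ν (p′ !) * ((sgn d * cross x (at p′ zs)) ^ p′ * N d (𝟙 ⊗ E (at p′ zs)))
      lowered = trans (*-congʳ (reflexive (≡.cong ν (≡.sym (rise-zero p′)))))
        (lower′ k (at p′ zs) (≡.trans (List.length-map _ zs) len′) x 0 (weight-top zs) p′ 0 (ℕ.+-identityʳ p′))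
      cancel : N d (E (at p′ (x ∷ zs))) ≈ (sgn d * cross x (at p′ zs)) ^ p′ * N d (𝟙 ⊗ E (at p′ zs))
      cancel = begin
        N d (E (at p′ (x ∷ zs)))                                 ≈⟨ trans (*-congʳ w-inverse) (*-identityˡ _) ⟨
        w * ν (p′ !) * N d (E (at p′ (x ∷ zs)))                  ≈⟨ trans (*-assoc _ _ _) (*-congˡ lowered) ⟩
        w * (ν (p′ !) * _)                                       ≈⟨ trans (sym (*-assoc _ _ _)) (trans (*-congʳ w-inverse) (*-identityˡ _)) ⟩
        (sgn d * cross x (at p′ zs)) ^ p′ * N d (𝟙 ⊗ E (at p′ zs)) ∎

    evaluate : ∀ m e g k zs → m ℕ.+ e ≡ p′ → e ≡ m ℕ.+ g → length zs ≡ suc (suc k) →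
      ν (e !) * ν (m !) ≈ sgn (suc e) →
      (∀ b → vandermonde zs * b ≈ 0# → b ≈ 0#) →
      let r = suc (suc k) in
      N (suc k) (E (at e zs)) ≈ sgn (tri (2 ℕ.+ r) ℕ.+ tri (suc r) ℕ.* e) * (ν ((r ℕ.* m) !) * ν (e !) ^ r) * vandermonde zs ^ g
    evaluate m e g k zs m+e≡p′ e≡m+g len wilson regular = begin
      n                                  ≈⟨ cancel (2 ℕ.* m) _ _ equation ⟩
      u * (P * sgn (tri d) * V ^ g)      ≈⟨ solve 4 (λ u p s v → u :* (p :* s :* v) := (u :* s) :* p :* v) refl _ _ _ _ ⟩
      u * sgn (tri d) * P * V ^ g        ≈⟨ *-congʳ (*-congʳ sign) ⟩
      sgn (tri (2 ℕ.+ r) ℕ.+ tri (suc r) ℕ.* e) * P * V ^ g ∎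
      where
      open Chain m e m+e≡p′ k
      r = suc (suc k)
      V = vandermonde zs
      n = N (suc k) (E (at e zs))
      P = ν ((r ℕ.* m) !) * ν (e !) ^ r
      -- This is the sign left when `descent` is multiplied by (e!)^r: Wilson turns (e! m!)^r into
      -- the first factor, and the second comes from the m-th power of the signed square of V. As t²
      -- = 1, it may change sides.
      t = sgn (suc e) ^ r * sgn (tri r) ^ m
      u = t

      cancel : ∀ j a b → V ^ j * a ≈ V ^ j * b → a ≈ b
      cancel zero    a b eq = trans (sym (*-identityˡ a)) (trans eq (*-identityˡ b))
      cancel (suc j) a b eq = cancel j a b (begin
        V ^ j * a                         ≈⟨ solve 2 (λ x y → x := (x :- y) :+ y) refl _ _ ⟩
        (V ^ j * a - V ^ j * b) + V ^ j * b ≈⟨ +-congʳ (regular _ (begin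
          V * (V ^ j * a - V ^ j * b)     ≈⟨ solve 4 (λ v w a b → v :* (w :* a :- w :* b) := (v :* w) :* a :- (v :* w) :* b) refl _ _ _ _ ⟩
          V ^ suc j * a - V ^ suc j * b   ≈⟨ +-congʳ eq ⟩
          V ^ suc j * b - V ^ suc j * b   ≈⟨ -‿inverseʳ _ ⟩
          0# ∎)) ⟩
        0# + V ^ j * b                    ≈⟨ +-identityˡ _ ⟩
        V ^ j * b ∎)

      t² : t * t ≈ 1#
      t² = begin
        t * t
          ≈⟨ solve 2 (λ a b → (a :* b) :* (a :* b) := (a :* a) :* (b :* b)) refl _ _ ⟩
        sgn (suc e) ^ r * sgn (suc e) ^ r * (sgn (tri r) ^ m * sgn (tri r) ^ m)
          ≈⟨ *-cong (square (suc e) r) (square (tri r) m) ⟩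
        1# * 1#  ≈⟨ *-identityˡ _ ⟩
        1# ∎
        where
        square : ∀ i j → sgn i ^ j * sgn i ^ j ≈ 1#
        square i j = trans (*-cong (sgn-^ i j) (sgn-^ i j)) (trans (sym (sgn-+ (j ℕ.* i) _)) (sgn-even (j ℕ.* i)))

      V-split : V ^ p′ ≈ V ^ (2 ℕ.* m) * V ^ g
      V-split = trans (reflexive (≡.cong (V ^_) (≡.trans (≡.sym m+e≡p′) (≡.trans (≡.cong (m ℕ.+_) e≡m+g)
        (ℕS.solve 2 (λ m g → m ℕS.:+ (m ℕS.:+ g) ℕS.:= (ℕS.con 2 ℕS.:* m) ℕS.:+ g) ≡.refl m g)))))
        (^-homo-* V (2 ℕ.* m) g)

      V² : (V * V) ^ m ≈ V ^ (2 ℕ.* m)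
      V² = trans (^-congˡ m (*-congˡ (sym (*-identityʳ V)))) (^-assocʳ V 2 m)

      equation : V ^ (2 ℕ.* m) * n ≈ V ^ (2 ℕ.* m) * (u * (P * sgn (tri d) * V ^ g))
      equation = sym (begin
        V ^ (2 ℕ.* m) * (t * (P * sgn (tri d) * V ^ g))
          ≈⟨ solve 6 (λ w t a b s v → w :* (t :* (a :* b :* s :* v)) := t :* (b :* (a :* (s :* (w :* v))))) refl _ _ _ _ _ _ ⟩
        t * (ν (e !) ^ r * (ν ((r ℕ.* m) !) * (sgn (tri d) * (V ^ (2 ℕ.* m) * V ^ g))))
          ≈⟨ *-congˡ (*-congˡ (*-congˡ (trans (*-congˡ (sym V-split)) (sym (top d zs len))))) ⟩
        t * (ν (e !) ^ r * (ν ((r ℕ.* m) !) * N d (E (at p′ zs))))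
          ≈⟨ *-congˡ (*-congˡ (descent zs len)) ⟩
        t * (ν (e !) ^ r * (ν (m !) ^ r * (sgn (tri r) * (V * V)) ^ m * n))
          ≈⟨ *-congˡ (*-congˡ (*-congʳ (*-congˡ (trans (^-distrib-* (sgn (tri r)) _ m) (*-congˡ V²))))) ⟩
        t * (ν (e !) ^ r * (ν (m !) ^ r * (sgn (tri r) ^ m * V ^ (2 ℕ.* m)) * n))
          ≈⟨ solve 6 (λ t a b s v n → t :* (a :* (b :* (s :* v) :* n)) := (t :* ((a :* b) :* s)) :* (v :* n)) refl _ _ _ _ _ _ ⟩
        t * ((ν (e !) ^ r * ν (m !) ^ r) * sgn (tri r) ^ m) * (V ^ (2 ℕ.* m) * n)
          ≈⟨ *-congʳ (*-congˡ (*-congʳ (trans (sym (^-distrib-* _ _ r)) (^-congˡ r wilson)))) ⟩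
        t * t * (V ^ (2 ℕ.* m) * n)
          ≈⟨ trans (*-congʳ t²) (*-identityˡ _) ⟩
        V ^ (2 ℕ.* m) * n ∎)

      -- The sum m + e is p-1, whose sign is 1 in R even for p = 2.
      parity : sgn m ≈ sgn e
      parity = begin
        sgn m                       ≈⟨ trans (*-congˡ (sgn-even e)) (*-identityʳ _) ⟨
        sgn m * sgn (e ℕ.+ e)       ≈⟨ *-congˡ (sgn-+ e e) ⟩
        sgn m * (sgn e * sgn e)     ≈⟨ trans (sym (*-assoc _ _ _)) (*-congʳ (sym (sgn-+ m e))) ⟩
        sgn (m ℕ.+ e) * sgn e       ≈⟨ trans (*-congʳ (trans (reflexive (≡.cong sgn m+e≡p′)) sgn-p′)) (*-identityˡ _) ⟩
        sgn e ∎

      sign : t * sgn (tri d) ≈ sgn (tri (2 ℕ.+ r) ℕ.+ tri (suc r) ℕ.* e)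
      sign = begin
        sgn (suc e) ^ r * sgn (tri r) ^ m * sgn (tri d)
          ≈⟨ *-congʳ (*-cong (sgn-^ (suc e) r) (trans (sgn-^ (tri r) m) (trans (reflexive (≡.cong sgn (ℕ.*-comm m (tri r))))
               (trans (sym (sgn-^ m (tri r))) (trans (^-congˡ (tri r) parity) (sgn-^ e (tri r))))))) ⟩
        sgn (r ℕ.* suc e) * sgn (tri r ℕ.* e) * sgn (tri d)
          ≈⟨ trans (sgn-+ (r ℕ.* suc e ℕ.+ tri r ℕ.* e) (tri d)) (*-congʳ (sgn-+ (r ℕ.* suc e) _)) ⟨
        sgn (r ℕ.* suc e ℕ.+ tri r ℕ.* e ℕ.+ tri d)
          -- The exponent obtained and the one in ε differ by exactly 2r.
          ≈⟨ trans (*-congˡ (sgn-even r)) (*-identityʳ _) ⟨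
        sgn (r ℕ.* suc e ℕ.+ tri r ℕ.* e ℕ.+ tri d) * sgn (r ℕ.+ r)
          ≈⟨ sgn-+ (r ℕ.* suc e ℕ.+ tri r ℕ.* e ℕ.+ tri d) (r ℕ.+ r) ⟨
        sgn (r ℕ.* suc e ℕ.+ tri r ℕ.* e ℕ.+ tri d ℕ.+ (r ℕ.+ r))
          ≡⟨ ≡.cong sgn (ℕS.solve 3 (λ d e t →
               let r = ℕS.con 1 ℕS.:+ d ; tr = d ℕS.:+ t in
               r ℕS.:* (ℕS.con 1 ℕS.:+ e) ℕS.:+ tr ℕS.:* e ℕS.:+ t ℕS.:+ (r ℕS.:+ r)
                 ℕS.:= ((ℕS.con 1 ℕS.:+ r) ℕS.:+ (r ℕS.:+ tr)) ℕS.:+ (r ℕS.:+ tr) ℕS.:* e) ≡.refl d e (tri d)) ⟩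
        sgn (tri (2 ℕ.+ r) ℕ.+ tri (suc r) ℕ.* e) ∎

-- Finite sums and formal power series.

module Sums (R : CommutativeRing 0ℓ 0ℓ) where
  open CommutativeRing R hiding (zero)
  open import Algebra.Properties.CommutativeSemigroup +-commutativeSemigroup using (interchange)

  ∑ : ℕ → (ℕ → Carrier) → Carrier
  ∑ zero    f = f zero
  ∑ (suc n) f = ∑ n f + f (suc n)

  ∑-cong : ∀ n {f g} → (∀ k → k ℕ.≤ n → f k ≈ g k) → ∑ n f ≈ ∑ n g
  ∑-cong zero    f≈g = f≈g 0 z≤n
  ∑-cong (suc n) f≈g = +-cong (∑-cong n (λ k k≤n → f≈g k (ℕ.m≤n⇒m≤1+n k≤n))) (f≈g (suc n) ℕ.≤-refl)

  ∑-+ : ∀ n f g → ∑ n (λ k → f k + g k) ≈ ∑ n f + ∑ n g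
  ∑-+ zero    f g = refl
  ∑-+ (suc n) f g = trans (+-congʳ (∑-+ n f g)) (interchange _ _ _ _)

  ∑-* : ∀ n a f → ∑ n (λ k → a * f k) ≈ a * ∑ n f
  ∑-* zero    a f = refl
  ∑-* (suc n) a f = trans (+-congʳ (∑-* n a f)) (sym (distribˡ a _ _))

  ∑-front : ∀ n f → ∑ (suc n) f ≈ f 0 + ∑ n (λ k → f (suc k))
  ∑-front zero    f = refl
  ∑-front (suc n) f = trans (+-congʳ (∑-front n f)) (+-assoc _ _ _)

  convolution : (ℕ → Carrier) → (ℕ → Carrier) → ℕ → Carrier
  convolution f g n = ∑ n (λ k → f k * g (n ∸ k))

-- Product and unit are parameters, known only up to equality in R, so that the laws hold for `_*S_`
-- and `1S` just as the statement defines them.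
module PowerSeries (R : CommutativeRing 0ℓ 0ℓ)
    (_⊛_ : (ℕ → CommutativeRing.Carrier R) → (ℕ → CommutativeRing.Carrier R) → ℕ → CommutativeRing.Carrier R)
    (⊛-convolution : ∀ f g n → CommutativeRing._≈_ R ((f ⊛ g) n) (Sums.convolution R f g n))
    (one : ℕ → CommutativeRing.Carrier R)
    (one-zero : CommutativeRing._≈_ R (one 0) (CommutativeRing.1# R))
    (one-suc : ∀ n → CommutativeRing._≈_ R (one (suc n)) (CommutativeRing.0# R)) where
  open CommutativeRing R hiding (zero)
  open Sums R
  open import Algebra.Properties.CommutativeSemigroup *-commutativeSemigroup using (x∙yz≈y∙xz)
  open import Relation.Binary.Reasoning.Setoid setoid

  Series : Set
  Series = ℕ → Carrier

  infix 4 _≋_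
  _≋_ : Series → Series → Set
  f ≋ g = ∀ n → f n ≈ g n

  tail : Series → Series
  tail f n = f (suc n)

  ⊛-zero : ∀ f g → (f ⊛ g) 0 ≈ f 0 * g 0
  ⊛-zero f g = ⊛-convolution f g 0

  ⊛-front : ∀ f g n → (f ⊛ g) (suc n) ≈ f 0 * g (suc n) + (tail f ⊛ g) n
  ⊛-front f g n = trans (⊛-convolution f g (suc n))
    (trans (∑-front n (λ k → f k * g (suc n ∸ k))) (+-congˡ (sym (⊛-convolution (tail f) g n))))

  ⊛-back : ∀ f g n → (f ⊛ g) (suc n) ≈ (f ⊛ tail g) n + f (suc n) * g 0
  ⊛-back f g n = trans (⊛-convolution f g (suc n)) (+-cong
    (trans (∑-cong n (λ k k≤n → *-congˡ (reflexive (≡.cong g (ℕ.+-∸-assoc 1 k≤n))))) (sym (⊛-convolution f (tail g) n)))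
    (*-congˡ (reflexive (≡.cong g (ℕ.n∸n≡0 n)))))

  ⊛-cong : ∀ {f f′ g g′} → f ≋ f′ → g ≋ g′ → f ⊛ g ≋ f′ ⊛ g′
  ⊛-cong f≋f′ g≋g′ n = trans (⊛-convolution _ _ n)
    (trans (∑-cong n (λ k _ → *-cong (f≋f′ k) (g≋g′ (n ∸ k)))) (sym (⊛-convolution _ _ n)))

  -- Splitting off the first summand of one product and the last of the other reduces the index by
  -- one, in place of reversing a sum.
  ⊛-comm : ∀ f g → f ⊛ g ≋ g ⊛ f
  ⊛-comm f g zero    = trans (⊛-zero f g) (trans (*-comm _ _) (sym (⊛-zero g f)))
  ⊛-comm f g (suc n) = begin
    (f ⊛ g) (suc n)                    ≈⟨ ⊛-front f g n ⟩
    f 0 * g (suc n) + (tail f ⊛ g) n   ≈⟨ +-cong (*-comm _ _) (⊛-comm (tail f) g n) ⟩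
    g (suc n) * f 0 + (g ⊛ tail f) n   ≈⟨ +-comm _ _ ⟩
    (g ⊛ tail f) n + g (suc n) * f 0   ≈⟨ ⊛-back g f n ⟨
    (g ⊛ f) (suc n) ∎

  ⊛-distribˡ : ∀ f g h → f ⊛ (λ n → g n + h n) ≋ (λ n → (f ⊛ g) n + (f ⊛ h) n)
  ⊛-distribˡ f g h n = trans (⊛-convolution _ _ n) (trans
    (trans (∑-cong n (λ k _ → distribˡ _ _ _)) (∑-+ n _ _)) (sym (+-cong (⊛-convolution f g n) (⊛-convolution f h n))))

  ⊛-distribʳ : ∀ f g h → (λ n → g n + h n) ⊛ f ≋ (λ n → (g ⊛ f) n + (h ⊛ f) n)
  ⊛-distribʳ f g h n = trans (⊛-comm _ f n) (trans (⊛-distribˡ f g h n) (+-cong (⊛-comm f g n) (⊛-comm f h n)))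

  ⊛-scalarʳ : ∀ a f g → f ⊛ (λ n → a * g n) ≋ (λ n → a * (f ⊛ g) n)
  ⊛-scalarʳ a f g n = trans (⊛-convolution _ _ n) (trans
    (trans (∑-cong n (λ k _ → x∙yz≈y∙xz _ _ _)) (∑-* n a _)) (*-congˡ (sym (⊛-convolution f g n))))

  ⊛-scalarˡ : ∀ a f g → (λ n → a * f n) ⊛ g ≋ (λ n → a * (f ⊛ g) n)
  ⊛-scalarˡ a f g n = trans (⊛-comm _ g n) (trans (⊛-scalarʳ a g f n) (*-congˡ (⊛-comm g f n)))

  ⊛-assoc : ∀ f g h → (f ⊛ g) ⊛ h ≋ f ⊛ (g ⊛ h)
  ⊛-assoc f g h zero    = trans (trans (⊛-zero _ h) (*-congʳ (⊛-zero f g)))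
    (trans (*-assoc _ _ _) (sym (trans (⊛-zero f _) (*-congˡ (⊛-zero g h)))))
  ⊛-assoc f g h (suc n) = begin
    ((f ⊛ g) ⊛ h) (suc n)
      ≈⟨ ⊛-front (f ⊛ g) h n ⟩
    (f ⊛ g) 0 * h (suc n) + (tail (f ⊛ g) ⊛ h) n
      ≈⟨ +-cong (trans (*-congʳ (⊛-zero f g)) (*-assoc _ _ _)) (⊛-cong (⊛-front f g) (λ _ → refl) n) ⟩
    f 0 * (g 0 * h (suc n)) + ((λ i → f 0 * g (suc i) + (tail f ⊛ g) i) ⊛ h) n
      ≈⟨ +-congˡ (⊛-distribʳ h _ _ n) ⟩
    f 0 * (g 0 * h (suc n)) + (((λ i → f 0 * g (suc i)) ⊛ h) n + ((tail f ⊛ g) ⊛ h) n)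
      ≈⟨ +-congˡ (+-cong (⊛-scalarˡ (f 0) (tail g) h n) (⊛-assoc (tail f) g h n)) ⟩
    f 0 * (g 0 * h (suc n)) + (f 0 * (tail g ⊛ h) n + (tail f ⊛ (g ⊛ h)) n)
      ≈⟨ trans (sym (+-assoc _ _ _)) (+-congʳ (sym (distribˡ _ _ _))) ⟩
    f 0 * (g 0 * h (suc n) + (tail g ⊛ h) n) + (tail f ⊛ (g ⊛ h)) n
      ≈⟨ +-congʳ (*-congˡ (⊛-front g h n)) ⟨
    f 0 * (g ⊛ h) (suc n) + (tail f ⊛ (g ⊛ h)) n
      ≈⟨ ⊛-front f (g ⊛ h) n ⟨
    (f ⊛ (g ⊛ h)) (suc n) ∎

  constant : Carrier → Series
  constant c zero    = c
  constant c (suc n) = 0#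

  variable-series : Series
  variable-series zero    = 0#
  variable-series (suc n) = constant 1# n

  0-⊛ : ∀ g → (λ _ → 0#) ⊛ g ≋ (λ _ → 0#)
  0-⊛ g n = trans (⊛-cong (λ _ → sym (zeroˡ 0#)) (λ _ → refl) n) (trans (⊛-scalarˡ 0# (λ _ → 0#) g n) (zeroˡ _))

  constant-⊛ : ∀ c g n → (constant c ⊛ g) n ≈ c * g n
  constant-⊛ c g zero    = ⊛-zero _ g
  constant-⊛ c g (suc n) = trans (⊛-front (constant c) g n) (trans (+-congˡ (0-⊛ g n)) (+-identityʳ _))

  variable-⊛-zero : ∀ g → (variable-series ⊛ g) 0 ≈ 0#
  variable-⊛-zero g = trans (⊛-zero _ g) (zeroˡ _)

  variable-⊛-suc : ∀ g n → (variable-series ⊛ g) (suc n) ≈ g n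
  variable-⊛-suc g n = trans (⊛-front variable-series g n)
    (trans (+-cong (zeroˡ _) (constant-⊛ 1# g n)) (trans (+-identityˡ _) (*-identityˡ _)))

  constant-cong : ∀ {a b} → a ≈ b → constant a ≋ constant b
  constant-cong a≈b zero    = a≈b
  constant-cong a≈b (suc n) = refl

  one-constant : one ≋ constant 1#
  one-constant zero    = one-zero
  one-constant (suc n) = one-suc n

  ⊛-identityˡ : ∀ g → one ⊛ g ≋ g
  ⊛-identityˡ g n = trans (⊛-cong one-constant (λ _ → refl) n) (trans (constant-⊛ 1# g n) (*-identityˡ _))

  ⊛-isCommutativeRing : IsCommutativeRing _≋_ (λ f g n → f n + g n) _⊛_ (λ f n → - f n) (λ _ → 0#) one
  ⊛-isCommutativeRing = record
    { isRing = record
      { +-isAbelianGroup = record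
        { isGroup = record
          { isMonoid = record
            { isSemigroup = record
              { isMagma = record
                { isEquivalence = record
                  { refl = λ _ → refl ; sym = λ f≋g n → sym (f≋g n) ; trans = λ f≋g g≋h n → trans (f≋g n) (g≋h n) }
                ; ∙-cong = λ f≋g h≋i n → +-cong (f≋g n) (h≋i n) }
              ; assoc = λ f g h n → +-assoc _ _ _ }
            ; identity = (λ f n → +-identityˡ _) , (λ f n → +-identityʳ _) }
          ; inverse = (λ f n → -‿inverseˡ _) , (λ f n → -‿inverseʳ _)
          ; ⁻¹-cong = λ f≋g n → -‿cong (f≋g n) }
        ; comm = λ f g n → +-comm _ _ }
      ; *-cong = ⊛-cong
      ; *-assoc = ⊛-assoc
      ; *-identity = ⊛-identityˡ , (λ g n → trans (⊛-comm g one n) (⊛-identityˡ g n))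
      ; distrib = ⊛-distribˡ , ⊛-distribʳ }
    ; *-comm = ⊛-comm }

  module _ (ι : FromIntegers R) where
    open _-Raw-AlmostCommutative⟶_ ι renaming (⟦_⟧ to ⟪_⟫)
    open RingProperties ring using (-0#≈0#)
    open IntegerCoefficients R ι

    derivative : Series → Series
    derivative f n = ⟪ + suc n ⟫ * f (suc n)

    private
      derivative-variable : ∀ f n → derivative (variable-series ⊛ f) n ≈ f n + (variable-series ⊛ derivative f) n
      derivative-variable f zero    = begin
        ⟪ + 1 ⟫ * (variable-series ⊛ f) 1   ≈⟨ *-cong 1-homo (variable-⊛-suc f 0) ⟩
        1# * f 0                            ≈⟨ trans (*-identityˡ _) (sym (+-identityʳ _)) ⟩
        f 0 + 0#                            ≈⟨ +-congˡ (variable-⊛-zero (derivative f)) ⟨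
        f 0 + (variable-series ⊛ derivative f) 0 ∎
      derivative-variable f (suc n) = begin
        ⟪ + suc (suc n) ⟫ * (variable-series ⊛ f) (suc (suc n))
          ≈⟨ *-cong (trans (+-homo (+ 1) (+ suc n)) (+-congʳ 1-homo)) (variable-⊛-suc f (suc n)) ⟩
        (1# + ⟪ + suc n ⟫) * f (suc n)
          ≈⟨ trans (distribʳ _ _ _) (+-congʳ (*-identityˡ _)) ⟩
        f (suc n) + derivative f n
          ≈⟨ +-congˡ (variable-⊛-suc (derivative f) n) ⟨
        f (suc n) + (variable-series ⊛ derivative f) (suc n) ∎

    powerSeries : SeriesRing R ι
    powerSeries = record
      { seriesRing  = record { isCommutativeRing = ⊛-isCommutativeRing }
      ; C           = constant
      ; C-cong      = constant-cong
      ; C-+         = λ { a b zero → refl ; a b (suc n) → sym (+-identityʳ _) }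
      ; C-*         = λ { a b zero → sym (⊛-zero _ _) ; a b (suc n) → sym (trans (constant-⊛ a _ (suc n)) (zeroʳ a)) }
      ; C-neg       = λ { a zero → refl ; a (suc n) → sym -0#≈0# }
      ; C-0         = λ { zero → refl ; (suc n) → refl }
      ; C-1         = λ n → sym (one-constant n)
      ; X           = variable-series
      ; coef        = λ n f → f n
      ; coef-cong   = λ n f≋g → f≋g n
      ; coef-⊕      = λ n f g → refl
      ; coef-C      = λ n a f → constant-⊛ a f n
      ; coef-X-suc  = λ n f → variable-⊛-suc f n
      ; coef-𝟙-zero = one-zero
      ; coef-𝟙-suc  = one-suc
      ; D           = derivative
      ; D-cong      = λ f≋g n → *-congˡ (f≋g (suc n))
      ; D-⊕         = λ f g n → distribˡ _ _ _
      ; D-C         = λ a f n → trans (*-congˡ (constant-⊛ a f (suc n)))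
                        (trans (x∙yz≈y∙xz _ _ _) (sym (constant-⊛ a (derivative f) n)))
      ; D-X         = derivative-variable
      ; D-𝟙         = λ n → trans (*-congˡ (one-suc n)) (zeroʳ _)
      ; coef-D      = λ n f → refl
      }

  Regular : Carrier → Set
  Regular a = ∀ b → a * b ≈ 0# → b ≈ 0#

  constant-regular : ∀ {v} → Regular v → ∀ f → constant v ⊛ f ≋ (λ _ → 0#) → f ≋ (λ _ → 0#)
  constant-regular {v} v-regular f eq n = v-regular (f n) (trans (sym (constant-⊛ v f n)) (eq n))

  -- The coefficient of index n in (X - v) f is f(n-1) - v f(n). Once f(n-1) is zero, regularity of
  -- v kills f(n), so the coefficients vanish from the bottom up.
  linear-regular : ∀ {v} → Regular v → ∀ f → (λ n → variable-series n - constant v n) ⊛ f ≋ (λ _ → 0#) → f ≋ (λ _ → 0#)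
  linear-regular {v} v-regular f eq = f≋0
    where
    open RingProperties ring using (-‿involutive; -0#≈0#; -‿distribˡ-*)
    neg-constant : (λ n → - constant v n) ≋ constant (- v)
    neg-constant zero    = refl
    neg-constant (suc n) = -0#≈0#
    split : ∀ n → (variable-series ⊛ f) n - v * f n ≈ 0#
    split n = trans (+-congˡ (trans (-‿distribˡ-* v (f n)) (sym (trans (⊛-cong neg-constant (λ _ → refl) n) (constant-⊛ (- v) f n)))))
      (trans (sym (⊛-distribʳ f variable-series (λ n → - constant v n) n)) (eq n))
    step : ∀ n → (variable-series ⊛ f) n ≈ 0# → f n ≈ 0#
    step n eq′ = v-regular (f n) (begin
      v * f n          ≈⟨ -‿involutive _ ⟨
      - - (v * f n)    ≈⟨ -‿cong (trans (sym (trans (+-congʳ eq′) (+-identityˡ _))) (split n)) ⟩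
      - 0#             ≈⟨ -0#≈0# ⟩
      0# ∎)
    f≋0 : f ≋ (λ _ → 0#)
    f≋0 zero    = step 0 (variable-⊛-zero f)
    f≋0 (suc n) = step (suc n) (trans (variable-⊛-suc f n) (f≋0 n))

-- Integers modulo p and iterated power series over them.

module IntegersModulo (p : ℕ) where

  ∣ᵤ-resp : ∀ {m n} → m ≡ n → (+ p) ℤS.∣ m → (+ p) ℤD.∣ n
  ∣ᵤ-resp ≡.refl = ℤS.∣⇒∣ᵤ

  infix 4 _~_
  _~_ : ℤ → ℤ → Set
  a ~ b = (+ p) ℤD.∣ (a ℤ.- b)

  reflexive~ : ∀ {a b} → a ≡ b → a ~ b
  reflexive~ {a} ≡.refl = ∣ᵤ-resp (≡.sym (ℤ.+-inverseʳ a)) (ℤS.divides (+ 0) ≡.refl)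

  ~-sym : ∀ {a b} → a ~ b → b ~ a
  ~-sym {a} {b} d = ∣ᵤ-resp (ℤR.solve 2 (λ a b → ℤR.:- (a ℤR.:- b) ℤR.:= b ℤR.:- a) ≡.refl a b)
    (ℤS.∣m⇒∣-m (ℤS.∣ᵤ⇒∣ {+ p} {a ℤ.- b} d))

  ~-trans : ∀ {a b c} → a ~ b → b ~ c → a ~ c
  ~-trans {a} {b} {c} d e = ∣ᵤ-resp (ℤR.solve 3 (λ a b c → (a ℤR.:- b) ℤR.:+ (b ℤR.:- c) ℤR.:= a ℤR.:- c) ≡.refl a b c)
    (ℤS.∣m∣n⇒∣m+n (ℤS.∣ᵤ⇒∣ {+ p} {a ℤ.- b} d) (ℤS.∣ᵤ⇒∣ {+ p} {b ℤ.- c} e))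

  ~-+-cong : ∀ {a b c d} → a ~ b → c ~ d → a ℤ.+ c ~ b ℤ.+ d
  ~-+-cong {a} {b} {c} {d} e f = ∣ᵤ-resp
    (ℤR.solve 4 (λ a b c d → (a ℤR.:- b) ℤR.:+ (c ℤR.:- d) ℤR.:= (a ℤR.:+ c) ℤR.:- (b ℤR.:+ d)) ≡.refl a b c d)
    (ℤS.∣m∣n⇒∣m+n (ℤS.∣ᵤ⇒∣ {+ p} {a ℤ.- b} e) (ℤS.∣ᵤ⇒∣ {+ p} {c ℤ.- d} f))

  ~-*-cong : ∀ {a b c d} → a ~ b → c ~ d → a ℤ.* c ~ b ℤ.* d
  ~-*-cong {a} {b} {c} {d} e f = ∣ᵤ-resp
    (ℤR.solve 4 (λ a b c d → (a ℤR.:- b) ℤR.:* c ℤR.:+ b ℤR.:* (c ℤR.:- d) ℤR.:= a ℤR.:* c ℤR.:- b ℤR.:* d) ≡.refl a b c d)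
    (ℤS.∣m∣n⇒∣m+n (ℤS.∣m⇒∣m*n c (ℤS.∣ᵤ⇒∣ {+ p} {a ℤ.- b} e)) (ℤS.∣n⇒∣m*n b (ℤS.∣ᵤ⇒∣ {+ p} {c ℤ.- d} f)))

  ~-neg-cong : ∀ {a b} → a ~ b → ℤ.- a ~ ℤ.- b
  ~-neg-cong {a} {b} d = ∣ᵤ-resp (ℤR.solve 2 (λ a b → ℤR.:- (a ℤR.:- b) ℤR.:= (ℤR.:- a) ℤR.:- (ℤR.:- b)) ≡.refl a b)
    (ℤS.∣m⇒∣-m (ℤS.∣ᵤ⇒∣ {+ p} {a ℤ.- b} d))

  isCommutativeRing : IsCommutativeRing _~_ ℤ._+_ ℤ._*_ (λ a → ℤ.- a) (+ 0) (+ 1)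
  isCommutativeRing = record
    { isRing = record
      { +-isAbelianGroup = record
        { isGroup = record
          { isMonoid = record
            { isSemigroup = record
              { isMagma = record
                { isEquivalence = record { refl = λ {a} → reflexive~ {a} ≡.refl ; sym = λ {a} → ~-sym {a} ; trans = λ {a} → ~-trans {a} }
                ; ∙-cong = λ {a} → ~-+-cong {a} }
              ; assoc = λ a b c → reflexive~ (ℤ.+-assoc a b c) }
            ; identity = (λ a → reflexive~ (ℤ.+-identityˡ a)) , (λ a → reflexive~ (ℤ.+-identityʳ a)) }
          ; inverse = (λ a → reflexive~ (ℤ.+-inverseˡ a)) , (λ a → reflexive~ (ℤ.+-inverseʳ a))
          ; ⁻¹-cong = λ {a} → ~-neg-cong {a} }
        ; comm = λ a b → reflexive~ (ℤ.+-comm a b) }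
      ; *-cong = λ {a} → ~-*-cong {a}
      ; *-assoc = λ a b c → reflexive~ (ℤ.*-assoc a b c)
      ; *-identity = (λ a → reflexive~ (ℤ.*-identityˡ a)) , (λ a → reflexive~ (ℤ.*-identityʳ a))
      ; distrib = (λ a b c → reflexive~ (ℤ.*-distribˡ-+ a b c)) , (λ a b c → reflexive~ (ℤ.*-distribʳ-+ a b c)) }
    ; *-comm = λ a b → reflexive~ (ℤ.*-comm a b) }

module Modulo (p : ℕ) where

  -- The operations are fixed to those of the statement and only the laws are built by recursion on
  -- the number of variables, so every ring in the tower has literally the carrier, product and
  -- congruence of the theorem.
  Laws : ℕ → Set
  Laws r = IsCommutativeRing {A = Ser r} (λ f g → f ≈[ p ] g) _+S_ _*S_ negS 0S 1S

  fromLaws : ∀ {r} → Laws r → CommutativeRing 0ℓ 0ℓ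
  fromLaws laws = record { isCommutativeRing = laws }

  *S-convolution : ∀ {r} (laws : Laws r) (f g : Ser (suc r)) n →
                   (f *S g) n ≈[ p ] Sums.convolution (fromLaws laws) f g n
  *S-convolution laws f g n = CommutativeRing.reflexive (fromLaws laws) (sumRange-∑ n _)
    where
    sumRange-∑ : ∀ n h → sumRange n h ≡ Sums.∑ (fromLaws laws) n h
    sumRange-∑ zero    h = ≡.refl
    sumRange-∑ (suc n) h = ≡.cong (_+S h (suc n)) (sumRange-∑ n h)

  laws : ∀ r → Laws r
  laws zero    = IntegersModulo.isCommutativeRing p
  laws (suc r) = PowerSeries.⊛-isCommutativeRing (fromLaws (laws r)) _*S_ (*S-convolution (laws r)) 1S
    (CommutativeRing.refl (fromLaws (laws r))) (λ _ → CommutativeRing.refl (fromLaws (laws r)))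

  serRing : ℕ → CommutativeRing 0ℓ 0ℓ
  serRing r = fromLaws (laws r)

  module Ser (r : ℕ) = CommutativeRing (serRing r)
  module Coefficients (r : ℕ) = PowerSeries (serRing r) _*S_ (*S-convolution (laws r)) 1S
    (Ser.refl r) (λ _ → Ser.refl r)

  constS-suc : ∀ {r} a → Ser._≈_ (suc r) (constS a) (Coefficients.constant r (constS a))
  constS-suc {r} a zero    = Ser.refl r
  constS-suc {r} a (suc n) = Ser.refl r

  constS-cong : ∀ r {a b} → (+ p) ℤD.∣ (a ℤ.- b) → Ser._≈_ r (constS a) (constS b)
  constS-cong zero    a~b         = a~b
  constS-cong (suc r) a~b zero    = constS-cong r a~b
  constS-cong (suc r) a~b (suc n) = Ser.refl r

  constS-+ : ∀ r a b → Ser._≈_ r (constS (a ℤ.+ b)) (constS a +S constS b)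
  constS-+ zero    a b         = Ser.refl 0 {a ℤ.+ b}
  constS-+ (suc r) a b zero    = constS-+ r a b
  constS-+ (suc r) a b (suc n) = Ser.sym r (Ser.+-identityˡ r _)

  constS-* : ∀ r a b → Ser._≈_ r (constS (a ℤ.* b)) (constS a *S constS b)
  constS-* zero    a b         = Ser.refl 0 {a ℤ.* b}
  constS-* (suc r) a b zero    = constS-* r a b
  constS-* (suc r) a b (suc n) = R.sym (R.trans (⊛-cong {g = constS b} (constS-suc a) (λ _ → R.refl) (suc n))
      (R.trans (constant-⊛ (constS a) (constS b) (suc n)) (R.zeroʳ _)))
    where
    module R = Ser r
    open Coefficients r

  constS-neg : ∀ r a → Ser._≈_ r (constS (ℤ.- a)) (negS (constS a))
  constS-neg zero    a         = Ser.refl 0 {ℤ.- a}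
  constS-neg (suc r) a zero    = constS-neg r a
  constS-neg (suc r) a (suc n) = Ser.sym r (RingProperties.-0#≈0# (Ser.ring r))

  constS-0 : ∀ r → Ser._≈_ r (constS (+ 0)) 0S
  constS-0 zero            = Ser.refl 0 {+ 0}
  constS-0 (suc r) zero    = constS-0 r
  constS-0 (suc r) (suc n) = Ser.refl r

  constS-homomorphism : ∀ r → FromIntegers (serRing r)
  constS-homomorphism r = record
    { ⟦_⟧    = constS
    ; +-homo = constS-+ r
    ; *-homo = constS-* r
    ; -‿homo = constS-neg r
    ; 0-homo = constS-0 r
    ; 1-homo = Ser.refl r
    }

-- Fermat's and Wilson's theorems.

prime-∤-! : ∀ {p} → Prime p → ∀ {n} → n ℕ.< p → ¬ p ∣ n !
prime-∤-! pr {zero}  n<p p∣1 = ℕ.<⇒≱ (ℕ.nonTrivial⇒n>1 _ {{prime⇒nonTrivial pr}}) (ℕD.∣⇒≤ p∣1)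
prime-∤-! pr {suc n} n<p p∣n! with euclidsLemma (suc n) (n !) pr p∣n!
... | inj₁ p∣n = ℕ.<⇒≱ n<p (ℕD.∣⇒≤ p∣n)
... | inj₂ p∣n!′ = prime-∤-! pr (ℕ.<-trans (ℕ.n<1+n n) n<p) p∣n!′

-- The binomial coefficient times two factorials of numbers below p equals p!, and p divides neither
-- factorial.
prime-∣-C : ∀ {p} → Prime p → ∀ k → suc k ℕ.< p → p ∣ p Comb.C suc k
prime-∣-C {suc n} pr k k<p = [ (λ d → d) , (λ d → ⊥-elim ([ prime-∤-! pr k<p , prime-∤-! pr n-k<p ]′ (euclidsLemma (suc k !) ((n ∸ k) !) pr d))) ]′
  (euclidsLemma (suc n Comb.C suc k) _ pr (≡.subst (suc n ∣_) (≡.sym p!) (ℕD.∣m⇒∣m*n (n !) ℕD.∣-refl)))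
  where
  instance _ = suc k ℕ.!* (n ∸ k) !≢0
  n-k<p : n ∸ k ℕ.< suc n
  n-k<p = s≤s (ℕ.m∸n≤m n k)
  p! : (suc n Comb.C suc k) ℕ.* (suc k ! ℕ.* (n ∸ k) !) ≡ suc n !
  p! = ≡.trans (≡.cong (ℕ._* (suc k ! ℕ.* (n ∸ k) !)) (Comb.nCk≡n!/k![n-k]! (ℕ.<⇒≤ k<p))) (m/n*n≡m (Comb.k![n∸k]!∣n! (ℕ.<⇒≤ k<p)))

module Wilson (R : CommutativeRing 0ℓ 0ℓ) (ι : FromIntegers R) (q : ℕ) (isPrime : Prime (suc (suc q)))
    (char : CommutativeRing._≈_ R (IntegerCoefficients.ν R ι (suc (suc q))) (CommutativeRing.0# R))
    (regular : ∀ a b → suc a ℕ.< suc (suc q) →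
       CommutativeRing._≈_ R (CommutativeRing._*_ R (IntegerCoefficients.ν R ι (suc a)) b) (CommutativeRing.0# R) →
       CommutativeRing._≈_ R b (CommutativeRing.0# R)) where
  open CommutativeRing R hiding (zero)
  open IntegerCoefficients R ι
  open Exp semiring using (_^_; ^-congˡ)
  open Mult semiring using () renaming (_×_ to _×′_)
  open Sum +-monoid using (sum; sum-init-last; sum-cong-≋; sum-replicate-zero)
  open import Relation.Binary.Reasoning.Setoid setoid

  private
    p′ p : ℕ
    p′ = suc q
    p  = suc p′

  ×-ν : ∀ n a → n ×′ a ≈ ν n * a
  ×-ν zero    a = sym (trans (*-congʳ ν-zero) (zeroˡ a))
  ×-ν (suc n) a = trans (+-congˡ (×-ν n a)) (sym (trans (*-congʳ (ν-suc n)) (trans (distribʳ _ _ _) (+-congʳ (*-identityˡ a)))))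

  ×-multiple : ∀ {n} a → p ∣ n → n ×′ a ≈ 0#
  ×-multiple a (divides k ≡.refl) =
    trans (×-ν (k ℕ.* p) a) (trans (*-congʳ (trans (ν-* k p) (trans (*-congˡ char) (zeroʳ _)))) (zeroˡ a))

  frobenius-+ : ∀ a b → (a + b) ^ p ≈ b ^ p + a ^ p
  frobenius-+ a b = begin
    (a + b) ^ p                                   ≈⟨ Binomial.theorem commutativeSemiring p a b ⟩
    term Fin.zero + sum (λ i → term (Fin.suc i))  ≈⟨ +-cong first (trans (sum-init-last (λ i → term (Fin.suc i))) (trans (+-cong middle final) (+-identityˡ _))) ⟩
    b ^ p + a ^ p ∎
    where
    binomial term : Fin (suc p) → Carrier
    binomial i = a ^ toℕ i * b ^ (p ∸ toℕ i)
    term i = (p Comb.C toℕ i) ×′ binomial i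
    first : term Fin.zero ≈ b ^ p
    first = trans (+-identityʳ _) (*-identityˡ _)
    middle : sum (λ i → term (Fin.suc (inject₁ i))) ≈ 0#
    middle = trans (sum-cong-≋ {n = p′} (λ i → ×-multiple (binomial (Fin.suc (inject₁ i))) (prime-∣-C isPrime (toℕ (inject₁ i))
      (s≤s (≡.subst (ℕ._< p′) (≡.sym (Fin.toℕ-inject₁ i)) (Fin.toℕ<n i)))))) (sum-replicate-zero p′)
    final : term (Fin.suc (Fin.fromℕ p′)) ≈ a ^ p
    final = begin
      (p Comb.C suc (toℕ (Fin.fromℕ p′))) ×′ (a ^ suc (toℕ (Fin.fromℕ p′)) * b ^ (p ∸ suc (toℕ (Fin.fromℕ p′))))
        ≡⟨ ≡.cong (λ k → (p Comb.C suc k) ×′ (a ^ suc k * b ^ (p ∸ suc k))) (Fin.toℕ-fromℕ p′) ⟩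
      (p Comb.C p) ×′ (a ^ p * b ^ (p′ ∸ p′))
        ≡⟨ ≡.cong₂ (λ k l → k ×′ (a ^ p * b ^ l)) (Comb.nCn≡1 p) (ℕ.n∸n≡0 p′) ⟩
      a ^ p * 1# + 0#
        ≈⟨ trans (+-identityʳ _) (*-identityʳ _) ⟩
      a ^ p ∎

  frobenius-ν : ∀ a → ν a ^ p ≈ ν a
  frobenius-ν zero    = trans (*-congʳ ν-zero) (trans (zeroˡ _) (sym ν-zero))
  frobenius-ν (suc a) = begin
    ν (suc a) ^ p       ≈⟨ ^-congˡ p (trans (ν-suc a) (+-comm _ _)) ⟩
    (ν a + 1#) ^ p      ≈⟨ frobenius-+ (ν a) 1# ⟩
    1# ^ p + ν a ^ p    ≈⟨ +-cong (1^ p) (frobenius-ν a) ⟩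
    1# + ν a            ≈⟨ ν-suc a ⟨
    ν (suc a) ∎

  fermat : ∀ a → suc a ℕ.< p → ν (suc a) ^ p′ ≈ 1#
  fermat a a<p = begin
    ν (suc a) ^ p′               ≈⟨ solve 1 (λ x → x := (x :- con (+ 1)) :+ con (+ 1)) refl _ ⟩
    (ν (suc a) ^ p′ - 1#) + 1#   ≈⟨ +-congʳ (regular a _ a<p (begin
      ν (suc a) * (ν (suc a) ^ p′ - 1#)   ≈⟨ solve 2 (λ x y → x :* (y :- con (+ 1)) := x :* y :- x) refl _ _ ⟩
      ν (suc a) ^ p - ν (suc a)           ≈⟨ +-congʳ (frobenius-ν (suc a)) ⟩
      ν (suc a) - ν (suc a)               ≈⟨ -‿inverseʳ _ ⟩
      0# ∎)) ⟩
    0# + 1#                      ≈⟨ +-identityˡ _ ⟩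
    1# ∎

  Δ : ℕ → (ℕ → Carrier) → ℕ → Carrier
  Δ zero    u k = u k
  Δ (suc n) u k = Δ n u (suc k) - Δ n u k

  -- Leibniz rule for iterated forward differences with the linear factor i.
  Δ-product : ∀ n u k → Δ (suc n) (λ i → ν i * u i) k ≈ ν k * Δ (suc n) u k + ν (suc n) * Δ n u (suc k)
  Δ-product zero    u k = trans (+-congʳ (*-congʳ (ν-suc k))) (trans
    (solve 3 (λ n x y → (con (+ 1) :+ n) :* x :- n :* y := n :* (x :- y) :+ con (+ 1) :* x) refl (ν k) (u (suc k)) (u k))
    (+-congˡ (*-congʳ (sym ν-one))))
  Δ-product (suc n) u k = trans (+-cong (Δ-product n u (suc k)) (-‿cong (Δ-product n u k)))
    (trans (+-congʳ (+-congʳ (*-congʳ (ν-suc k))))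
    (trans (solve 5 (λ k n x y z → ((con (+ 1) :+ k) :* (x :- y) :+ n :* x) :- (k :* (y :- z) :+ n :* y)
                     := k :* ((x :- y) :- (y :- z)) :+ (con (+ 1) :+ n) :* (x :- y)) refl
              (ν k) (ν (suc n)) (Δ n u (suc (suc k))) (Δ n u (suc k)) (Δ n u k))
      (+-congˡ (*-congʳ (sym (ν-suc (suc n)))))))

  -- By induction the n-th difference of the n-th power is constant in k, so in the Leibniz rule the
  -- term with one more difference vanishes.
  Δ-power : ∀ n k → Δ n (λ i → ν i ^ n) k ≈ ν (n !)
  Δ-power zero    k = sym ν-one
  Δ-power (suc n) k = begin
    Δ (suc n) (λ i → ν i * ν i ^ n) k
      ≈⟨ Δ-product n (λ i → ν i ^ n) k ⟩
    ν k * (Δ n (λ i → ν i ^ n) (suc k) - Δ n (λ i → ν i ^ n) k) + ν (suc n) * Δ n (λ i → ν i ^ n) (suc k)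
      ≈⟨ +-cong (*-congˡ (+-cong (Δ-power n (suc k)) (-‿cong (Δ-power n k)))) (*-congˡ (Δ-power n (suc k))) ⟩
    ν k * (ν (n !) - ν (n !)) + ν (suc n) * ν (n !)
      ≈⟨ solve 3 (λ k x y → k :* (x :- x) :+ y := y) refl (ν k) (ν (n !)) _ ⟩
    ν (suc n) * ν (n !)
      ≈⟨ ν-* (suc n) (n !) ⟨
    ν (suc n !) ∎

  -- The last of the n+1 values entering an n-th difference has coefficient 1, so a deviation there
  -- passes through unchanged.
  Δ-vanishing : ∀ n u k c → (∀ i → i ℕ.< n → u (i ℕ.+ k) ≈ c) → ∀ e → u (n ℕ.+ k) ≈ c + e →
                Δ n u k ≈ Δ n (λ _ → c) k + e
  Δ-vanishing zero    u k c _     e uk = uk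
  Δ-vanishing (suc n) u k c const e uk = begin
    Δ n u (suc k) - Δ n u k
      ≈⟨ +-cong (Δ-vanishing n u (suc k) c (λ i i<n → shift i (const (suc i) (s≤s i<n))) e (shift n uk))
           (-‿cong (Δ-vanishing n u k c (λ i i<n → const i (ℕ.m<n⇒m<1+n i<n)) 0# (trans (const n ℕ.≤-refl) (sym (+-identityʳ _))))) ⟩
    (Δ n (λ _ → c) (suc k) + e) - (Δ n (λ _ → c) k + 0#)
      ≈⟨ solve 3 (λ x y e → (x :+ e) :- (y :+ con (+ 0)) := (x :- y) :+ e) refl _ _ _ ⟩
    Δ (suc n) (λ _ → c) k + e ∎
    where
    shift : ∀ i {b} → u (suc i ℕ.+ k) ≈ b → u (i ℕ.+ suc k) ≈ b
    shift i eq = trans (reflexive (≡.cong u (ℕ.+-suc i k))) eq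

  Δ-constant : ∀ n c k → Δ (suc n) (λ _ → c) k ≈ 0#
  Δ-constant zero    c k = -‿inverseʳ c
  Δ-constant (suc n) c k = trans (+-cong (Δ-constant n c (suc k)) (-‿cong (Δ-constant n c k))) (-‿inverseʳ 0#)

  -- By Fermat, i ^ (p-1) is 1 for 1 ≤ i < p and 0 at i = p; its (p-1)-st difference is (p-1)!.
  wilson : ν (p′ !) ≈ - 1#
  wilson = begin
    ν (p′ !)                        ≈⟨ Δ-power p′ 1 ⟨
    Δ p′ (λ i → ν i ^ p′) 1         ≈⟨ Δ-vanishing p′ (λ i → ν i ^ p′) 1 1# ones (- 1#) last ⟩
    Δ p′ (λ _ → 1#) 1 + - 1#        ≈⟨ +-congʳ (Δ-constant q 1# 1) ⟩
    0# + - 1#                       ≈⟨ +-identityˡ _ ⟩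
    - 1# ∎
    where
    ones : ∀ i → i ℕ.< p′ → ν (i ℕ.+ 1) ^ p′ ≈ 1#
    ones i i<p′ = trans (reflexive (≡.cong (λ j → ν j ^ p′) (ℕ.+-comm i 1))) (fermat i (s≤s i<p′))
    last : ν (p′ ℕ.+ 1) ^ p′ ≈ 1# + - 1#
    last = trans (^-congˡ p′ (trans (reflexive (≡.cong ν (ℕ.+-comm p′ 1))) char))
      (trans (zeroˡ _) (sym (-‿inverseʳ 1#)))

  -- The case m = 0 is Wilson's theorem. Trading the top factor of one factorial for a new top
  -- factor of the other costs a sign, by `ν-complement`.
  factorial-complement : ∀ m n → m ℕ.+ n ≡ p′ → ν (n !) * ν (m !) ≈ sgn (suc m)
  factorial-complement zero    n ≡.refl = trans (*-congˡ ν-one) (trans (*-identityʳ _) wilson)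
  factorial-complement (suc m) n m+n≡p′ = begin
    ν (n !) * ν (suc m !)
      ≈⟨ *-congˡ (ν-* (suc m) (m !)) ⟩
    ν (n !) * (ν (suc m) * ν (m !))
      ≈⟨ solve 3 (λ a b c → a :* (b :* c) := :- ((:- b) :* a :* c)) refl _ _ _ ⟩
    - (- ν (suc m) * ν (n !) * ν (m !))
      ≈⟨ -‿cong (*-congʳ (trans (ν-* (suc n) (n !)) (*-congʳ (ν-complement char (suc m) n m+n≡p′)))) ⟨
    - (ν (suc n !) * ν (m !))
      ≈⟨ -‿cong (factorial-complement m (suc n) (≡.trans (ℕ.+-suc m n) m+n≡p′)) ⟩
    - sgn (suc m) ∎

  -- Comparing the two ends m = 0 and m = p-1 of `factorial-complement` gives this for odd p and p =
  -- 2 alike.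
  sgn-p′ : sgn p′ ≈ 1#
  sgn-p′ = begin
    sgn p′                       ≈⟨ solve 1 (λ x → x := :- (:- x)) refl _ ⟩
    - sgn p                      ≈⟨ -‿cong (factorial-complement p′ 0 (ℕ.+-identityʳ p′)) ⟨
    - (ν 1 * ν (p′ !))           ≈⟨ -‿cong (*-cong ν-one wilson) ⟩
    - (1# * - 1#)                ≈⟨ solve 0 (:- (con (+ 1) :* :- con (+ 1)) := con (+ 1)) refl ⟩
    1# ∎

-- Translation from the determinant and variables of the statement.

module Bridge (p : ℕ) (r : ℕ) where
  open Modulo p
  open Ser r hiding (zero)
  open import Relation.Binary.Reasoning.Setoid setoid
  open IntegerCoefficients (serRing r) (constS-homomorphism r)
  open Exp semiring using (_^_)

  S : SeriesRing (serRing r) (constS-homomorphism r)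
  S = Coefficients.powerSeries r (constS-homomorphism r)

  open SeriesRing S
  open Alternation (serRing r) (constS-homomorphism r) S
  open Polynomials (serRing r) (constS-homomorphism r) S
  open Exp ≋.semiring using () renaming (_^_ to _↑_)

  sumFin-cong : ∀ n {F G : Fin n → Ser r} → (∀ i → F i ≈ G i) → sumFin n F ≈ sumFin n G
  sumFin-cong zero    F≈G = refl
  sumFin-cong (suc n) F≈G = +-cong (F≈G zero) (sumFin-cong n (λ i → F≈G (suc i)))

  sumFin-neg : ∀ n (F : Fin n → Ser r) → sumFin n (λ i → - F i) ≈ - sumFin n F
  sumFin-neg zero    F = solve 0 (con (+ 0) := :- con (+ 0)) refl
  sumFin-neg (suc n) F = trans (+-congˡ (sumFin-neg n (λ i → F (suc i))))
    (solve 2 (λ x y → :- x :+ :- y := :- (x :+ y)) refl _ _)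

  constS-sgn : ∀ n → constS (-1ℤ ℤ.^ n) ≈ sgn n
  constS-sgn zero    = refl
  constS-sgn (suc n) = begin
    constS (-1ℤ ℤ.* -1ℤ ℤ.^ n)         ≡⟨ ≡.cong constS (ℤ.-1*i≡-i (-1ℤ ℤ.^ n)) ⟩
    constS (ℤ.- (-1ℤ ℤ.^ n))           ≈⟨ constS-neg r _ ⟩
    - constS (-1ℤ ℤ.^ n)               ≈⟨ -‿cong (constS-sgn n) ⟩
    - sgn n ∎

  constS-^ : ∀ a n → constS (a ℤ.^ n) ≈ constS a ^ n
  constS-^ a zero    = refl
  constS-^ a (suc n) = trans (constS-* r a (a ℤ.^ n)) (*-congˡ (constS-^ a n))

  lookup-removeAt : ∀ {n} (v : Vec 𝔸 (suc n)) i j → lookup (removeAt v i) j ≡ lookup v (punchIn i j)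
  lookup-removeAt (f ∷ v)     zero    j       = ≡.refl
  lookup-removeAt (f ∷ g ∷ v) (suc i) zero    = ≡.refl
  lookup-removeAt (f ∷ g ∷ v) (suc i) (suc j) = lookup-removeAt (g ∷ v) i j

  -- The nested subtractions of `∂` unfold to the explicit alternating signs of the Laplace sum.
  ∂-sumFin : ∀ n φ (F : Form n) v →
    sumFin (suc n) (λ j → sgn (toℕ j) * (φ (lookup v j) * F (removeAt v j))) ≈ ∂ φ F v
  ∂-sumFin zero    φ F (f ∷ []) = trans (+-identityʳ _) (*-identityˡ _)
  ∂-sumFin (suc n) φ F (f ∷ g ∷ v) = +-cong (*-identityˡ _) (begin
    sumFin (suc n) (λ j → - sgn (toℕ j) * (φ (lookup (g ∷ v) j) * F (f ∷ removeAt (g ∷ v) j)))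
      ≈⟨ sumFin-cong (suc n) (λ j → solve 2 (λ x y → (:- x) :* y := :- (x :* y)) refl (sgn (toℕ j)) (φ (lookup (g ∷ v) j) * F (f ∷ removeAt (g ∷ v) j))) ⟩
    sumFin (suc n) (λ j → - (sgn (toℕ j) * (φ (lookup (g ∷ v) j) * F (f ∷ removeAt (g ∷ v) j))))
      ≈⟨ sumFin-neg (suc n) (λ j → sgn (toℕ j) * (φ (lookup (g ∷ v) j) * F (f ∷ removeAt (g ∷ v) j))) ⟩
    - sumFin (suc n) (λ j → sgn (toℕ j) * (φ (lookup (g ∷ v) j) * F (f ∷ removeAt (g ∷ v) j)))
      ≈⟨ -‿cong (∂-sumFin n φ (F ▹ f) (g ∷ v)) ⟩
    - ∂ φ (F ▹ f) (g ∷ v) ∎)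

  det-Det : ∀ n φ v (M : Fin n → Fin n → Ser r) → (∀ i j → M i j ≈ φ (toℕ i) (lookup v j)) →
            det n M ≈ Det n φ v
  det-Det zero    φ v M M≈ = refl
  det-Det (suc n) φ v M M≈ = trans
    (sumFin-cong (suc n) (λ j → trans (*-cong (*-cong (constS-sgn (toℕ j)) (M≈ zero j))
      (det-Det n (λ i → φ (suc i)) (removeAt v j) _ (λ i k → trans (M≈ (suc i) (punchIn j k))
        (reflexive (≡.cong (φ (suc (toℕ i))) (≡.sym (lookup-removeAt v j k)))))))
      (*-assoc _ _ _)))
    (∂-sumFin n (φ 0) (Det n (λ i → φ (suc i))) v)

  ^S-^ : ∀ a n → a ^S n ≡ a ^ n
  ^S-^ a zero    = ≡.refl
  ^S-^ a (suc n) = ≡.cong (a *S_) (^S-^ a n)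

  ^S-↑ : ∀ (f : Ser (suc r)) n → f ^S n ≡ f ↑ n
  ^S-↑ f zero    = ≡.refl
  ^S-↑ f (suc n) = ≡.cong (f *S_) (^S-↑ f n)

  lookup-pows : ∀ d f j → lookup (pows d f) j ≡ X ↑ (d ∸ suc (toℕ j)) ⊗ f
  lookup-pows (suc d) f zero    = ≡.refl
  lookup-pows (suc d) f (suc j) = lookup-pows d f j

  varS-zero : varS zero ≋ X
  varS-zero zero          = refl
  varS-zero (suc zero)    = refl
  varS-zero (suc (suc n)) = refl

  varS-suc : ∀ (i : Fin r) → varS (suc i) ≋ C (varS i)
  varS-suc i zero    = refl
  varS-suc i (suc n) = refl

-- Differences of variables are not zero divisors.

module RegularElements (p : ℕ) where
  open Modulo p

  Regular : ∀ r → Ser r → Set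
  Regular r = Coefficients.Regular r

  module _ {r : ℕ} where
    open Ser r hiding (zero)

    Regular-resp : ∀ {a b} → a ≈ b → Regular r a → Regular r b
    Regular-resp a≈b a-regular c bc≈0 = a-regular c (trans (*-congʳ a≈b) bc≈0)

    Regular-* : ∀ {a b} → Regular r a → Regular r b → Regular r (a * b)
    Regular-* a-regular b-regular c eq = b-regular c (a-regular _ (trans (sym (*-assoc _ _ _)) eq))

    Regular-1 : Regular r 1S
    Regular-1 c eq = trans (sym (*-identityˡ c)) eq

  varS-regular : ∀ r i → Regular r (varS i)
  varS-regular (suc r) zero    f eq n = R.trans (R.sym (variable-⊛-suc f n))
    (R.trans (⊛-cong {g = f} (λ k → R.sym (Bridge.varS-zero p r k)) (λ _ → R.refl) (suc n)) (eq (suc n)))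
    where
    module R = Ser r
    open Coefficients r
  varS-regular (suc r) (suc i) = Regular-resp (λ n → Ser.sym r (Bridge.varS-suc p r i n))
    (Coefficients.constant-regular r (varS-regular r i))

  -- If i is the outermost variable, the difference is X - v with v a regular variable of the
  -- coefficient ring. Otherwise it is a constant from that ring.
  varS-difference-regular : ∀ r i j → toℕ i ℕ.< toℕ j → Regular r (varS i -S varS j)
  varS-difference-regular (suc r) zero    (suc j) _ =
    Regular-resp (λ n → R.sym (R.+-cong (Bridge.varS-zero p r n) (R.-‿cong (Bridge.varS-suc p r j n))))
      (Coefficients.linear-regular r (varS-regular r j))
    where module R = Ser r
  varS-difference-regular (suc r) (suc i) (suc j) (s≤s i<j) =
    Regular-resp difference (Coefficients.constant-regular r (varS-difference-regular r i j i<j))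
    where
    module R = Ser r
    difference : ∀ n → Ser._≈_ r (Coefficients.constant r (varS i -S varS j) n) ((varS (suc i) -S varS (suc j)) n)
    difference zero    = R.refl
    difference (suc n) = R.sym (R.-‿inverseʳ 0S)

-- The determinants of the three families.

module Evaluation (q : ℕ) (isPrime : Prime (suc (suc q))) where

  p′ p : ℕ
  p′ = suc q
  p  = suc p′

  open Modulo p

  characteristic-p : ∀ r → Ser._≈_ r (constS (+ p)) 0S
  characteristic-p r = Ser.trans r (constS-cong r (≡.subst (ℕD._∣_ p) (≡.sym (ℕ.+-identityʳ p)) ℕD.∣-refl)) (constS-0 r)

  infix 4 ∤_
  ∤_ : ℤ → Set
  ∤ a = ¬ ((+ p) ℤD.∣ a)

  ∤-* : ∀ {a b} → ∤ a → ∤ b → ∤ a ℤ.* b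
  ∤-* {a} {b} ∤a ∤b d = [ ∤a , ∤b ]′ (euclidsLemma ℤ.∣ a ∣ ℤ.∣ b ∣ isPrime (≡.subst (ℕD._∣_ p) (ℤ.abs-* a b) d))

  ∤-^ : ∀ {a} → ∤ a → ∀ n → ∤ a ℤ.^ n
  -- As `0 !` is 1, this says that p does not divide 1.
  ∤-^ ∤a zero    = prime-∤-! isPrime {0} (s≤s z≤n)
  ∤-^ {a} ∤a (suc n) = ∤-* {a} ∤a (∤-^ ∤a n)

  ∤-sign : ∀ n → ∤ -1ℤ ℤ.^ n
  ∤-sign = ∤-^ {ℤ.-1ℤ} (prime-∤-! isPrime {0} (s≤s z≤n))

  private
    regular : ∀ a b → suc a ℕ.< p → (+ p) ℤD.∣ ((+ suc a) ℤ.* b ℤ.- + 0) → (+ p) ℤD.∣ (b ℤ.- + 0)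
    regular a b a<p d = ≡.subst (ℤD._∣_ (+ p)) (≡.sym (ℤ.+-identityʳ b))
      ([ (λ p∣a → ⊥-elim (ℕ.<⇒≱ a<p (ℕD.∣⇒≤ p∣a))) , (λ p∣b → p∣b) ]′
        (euclidsLemma (suc a) ℤ.∣ b ∣ isPrime (≡.subst (ℕD._∣_ p)
          (≡.trans (≡.cong ℤ.∣_∣ (ℤ.+-identityʳ ((+ suc a) ℤ.* b))) (ℤ.abs-* (+ suc a) b)) d)))

  module W = Wilson (serRing 0) (constS-homomorphism 0) q isPrime (characteristic-p 0) regular

  module _ (r : ℕ) where
    open Ser r hiding (zero)
    open import Relation.Binary.Reasoning.Setoid setoid
    open Bridge p r
    open IntegerCoefficients (serRing r) (constS-homomorphism r)
    open SeriesRing S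
    open Alternation (serRing r) (constS-homomorphism r) S
    open Polynomials (serRing r) (constS-homomorphism r) S
    open Determinants (serRing r) (constS-homomorphism r) S p′ (characteristic-p r)
    open Exponents (serRing r) (constS-homomorphism r) S p′ (characteristic-p r)
    open Exp ≋.semiring using () renaming (_^_ to _↑_; ^-congˡ to ↑-congˡ)
    open CommutativeExp ≋.commutativeSemiring using () renaming (^-distrib-* to ↑-distrib-⊗)

    prodFin-cong : ∀ n {F G : Fin n → Ser r} → (∀ i → F i ≈ G i) → prodFin n F ≈ prodFin n G
    prodFin-cong zero    F≈G = refl
    prodFin-cong (suc n) F≈G = *-cong (F≈G zero) (prodFin-cong n (λ i → F≈G (suc i)))

    diffs-prodFin : ∀ n a (x : Fin n → Ser r) → prodFin n (λ i → a -S x i) ≈ diffs a (tabulate x)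
    diffs-prodFin zero    a x = refl
    diffs-prodFin (suc n) a x = *-congˡ (diffs-prodFin n a (λ i → x (suc i)))

    -- In the square array of `delta` the entries with j = 0 are all 1. Without them, row 0 lists
    -- the differences from the first point and the other rows form the same array for the remaining
    -- points.
    vandermonde-prodFin : ∀ n (x : Fin n → Ser r) →
      prodFin n (λ i → prodFin n (λ j → if toℕ i ℕ.<ᵇ toℕ j then x i -S x j else 1S)) ≈ vandermonde (tabulate x)
    vandermonde-prodFin zero    x = refl
    vandermonde-prodFin (suc n) x = *-cong
      (trans (*-identityˡ _) (diffs-prodFin n (x zero) (λ i → x (suc i))))
      (trans (prodFin-cong n (λ i → *-identityˡ _)) (vandermonde-prodFin n (λ i → x (suc i))))

    zs : List (Ser r)
    zs = tabulate varS

    delta-vandermonde : delta r ≈ vandermonde zs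
    delta-vandermonde = vandermonde-prodFin r varS

    E-prodFin : ∀ e n (F : Fin n → Ser (suc r)) (x : Fin n → Ser r) → (∀ i → F i ≋ L (x i)) →
                prodFin n F ↑ e ≋ E (at e (tabulate x))
    E-prodFin e zero    F x F≋ = one-power e
      where
      one-power : ∀ e → 𝟙 ↑ e ≋ 𝟙
      one-power zero    = ≋-refl
      one-power (suc e) = ≋-trans (≋.*-identityˡ _) (one-power e)
    E-prodFin e (suc n) F x F≋ = ≋-trans (↑-distrib-⊗ (F zero) _ e)
      (⊗-cong (↑-congˡ e (F≋ zero)) (E-prodFin e n (λ i → F (suc i)) (λ i → x (suc i)) (λ i → F≋ (suc i))))

    fPoly-E : ∀ e → fPoly r ^S e ≋ E (at e zs)
    fPoly-E e = ≋-trans (≋-reflexive (^S-↑ (fPoly r) e))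
      (E-prodFin e r _ varS (λ i → ⊕-cong varS-zero (⊖-cong (varS-suc i))))

    -- Multiplying by the power d-1-j of X moves the index (i+1)p + j - d, with i and j counted from
    -- 0, to (i+1)p - 1, the same for all columns. The bound d ≤ p ensures that the truncated
    -- subtraction is a true one.
    det-Mmat : ∀ e d → d ℕ.≤ p → det d (Mmat p r e d) ≈ N d (E (at e zs))
    det-Mmat e d d≤p = trans
      (det-Det d φ (pows d (fPoly r ^S e)) (Mmat p r e d) entry)
      (N-cong d (fPoly-E e))
      where
      entry : ∀ i j → Mmat p r e d i j ≈ φ (toℕ i) (lookup (pows d (fPoly r ^S e)) j)
      entry i j = begin
        coeffFe r e ((suc (toℕ i) ℕ.* p ℕ.+ b) ∸ d)
          ≈⟨ coef-X↑ k _ (fPoly r ^S e) ⟨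
        coef (k ℕ.+ ((suc (toℕ i) ℕ.* p ℕ.+ b) ∸ d)) (X ↑ k ⊗ (fPoly r ^S e))
          ≡⟨ ≡.cong₂ coef index (≡.sym (lookup-pows d _ j)) ⟩
        φ (toℕ i) (lookup (pows d (fPoly r ^S e)) j) ∎
        where
        b = toℕ j
        k = d ∸ suc b
        P = p′ ℕ.+ toℕ i ℕ.* p
        b+k : suc b ℕ.+ k ≡ d
        b+k = ℕ.m+[n∸m]≡n (Fin.toℕ<n j)
        k≤P : k ℕ.≤ P
        k≤P = ℕ.≤-trans (ℕ.∸-monoˡ-≤ {d} {p} (suc b) d≤p) (ℕ.≤-trans (ℕ.m∸n≤m p′ b) (ℕ.m≤m+n p′ _))
        index : k ℕ.+ ((suc P ℕ.+ b) ∸ d) ≡ P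
        index = ≡.trans (≡.cong (λ i → k ℕ.+ ((suc P ℕ.+ b) ∸ i)) (≡.sym b+k))
          (≡.trans (≡.cong (λ i → k ℕ.+ (i ∸ (b ℕ.+ k))) (ℕ.+-comm P b))
          (≡.trans (≡.cong (k ℕ.+_) (ℕ.[m+n]∸[m+o]≡n∸o b P k)) (ℕ.m+[n∸m]≡n k≤P)))

    open RegularElements p

    diffs-regular : ∀ n a (x : Fin n → Ser r) → (∀ i → Regular r (a -S x i)) → Regular r (diffs a (tabulate x))
    diffs-regular zero    a x reg = Regular-1
    diffs-regular (suc n) a x reg = Regular-* (reg zero) (diffs-regular n a (λ i → x (suc i)) (λ i → reg (suc i)))

    vandermonde-regular : ∀ n (x : Fin n → Ser r) → (∀ i j → toℕ i ℕ.< toℕ j → Regular r (x i -S x j)) →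
                          Regular r (vandermonde (tabulate x))
    vandermonde-regular zero    x reg = Regular-1
    vandermonde-regular (suc n) x reg = Regular-*
      (diffs-regular n (x zero) (λ i → x (suc i)) (λ i → reg zero (suc i) (s≤s z≤n)))
      (vandermonde-regular n (λ i → x (suc i)) (λ i j i<j → reg (suc i) (suc j) (s≤s i<j)))

    zs-length : length zs ≡ r
    zs-length = List.length-tabulate varS

    private
      sgn₀ : ℕ → ℤ
      sgn₀ = IntegerCoefficients.sgn (serRing 0) (constS-homomorphism 0)

    -- Wilson's theorem is proved with no variables, where small integers can be cancelled by
    -- Euclid's lemma, and is carried to r variables by this.
    constS-signed : ∀ a n → Ser._≈_ 0 a (sgn₀ n) → constS a ≈ sgn n
    constS-signed a n a≈ = trans
      (constS-cong r {a} { -1ℤ ℤ.^ n } (Ser.trans 0 {a} {sgn₀ n} { -1ℤ ℤ.^ n } a≈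
        (Ser.sym 0 { -1ℤ ℤ.^ n } {sgn₀ n} (Bridge.constS-sgn p 0 n))))
      (constS-sgn n)

    factorials : ∀ m e → m ℕ.+ e ≡ p′ → ν (e !) * ν (m !) ≈ sgn (suc e)
    factorials m e m+e≡p′ = trans (*-comm _ _) (trans (sym (constS-* r (+ (m !)) (+ (e !))))
      (constS-signed ((+ (m !)) ℤ.* (+ (e !))) (suc e) (W.factorial-complement e m (≡.trans (ℕ.+-comm e m) m+e≡p′))))

    factorial-inverse : - 1# * ν (p′ !) ≈ 1#
    factorial-inverse = trans (*-congˡ (constS-signed (+ (p′ !)) 1 W.wilson))
      (solve 0 (:- con (+ 1) :* :- con (+ 1) := con (+ 1)) refl)

    sgn-p′ : sgn p′ ≈ 1#
    sgn-p′ = trans (sym (constS-sgn p′)) (constS-signed (-1ℤ ℤ.^ p′) 0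
      (Ser.trans 0 { -1ℤ ℤ.^ p′ } {sgn₀ p′} {sgn₀ 0} (Bridge.constS-sgn p 0 p′) W.sgn-p′))

  tri-/2 : ∀ n → (n ℕ.* suc n) / 2 ≡ tri (suc n)
  tri-/2 n = ≡.trans (≡.cong (_/ 2) (double n)) (m*n/n≡m (tri (suc n)) 2)
    where
    double : ∀ n → n ℕ.* suc n ≡ tri (suc n) ℕ.* 2
    double zero    = ≡.refl
    double (suc n) = ≡.trans
      (ℕS.solve 1 (λ n → (ℕS.con 1 ℕS.:+ n) ℕS.:* (ℕS.con 2 ℕS.:+ n)
        ℕS.:= n ℕS.:* (ℕS.con 1 ℕS.:+ n) ℕS.:+ (ℕS.con 1 ℕS.:+ n) ℕS.:* ℕS.con 2) ≡.refl n)
      (≡.trans (≡.cong (ℕ._+ suc n ℕ.* 2) (double n))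
        (≡.trans (ℕ.+-comm (tri (suc n) ℕ.* 2) _) (≡.sym (ℕ.*-distribʳ-+ 2 (suc n) (tri (suc n))))))

  ∤-eps0 : ∀ r e → r ℕ.* (p′ ∸ e) ℕ.≤ p′ → e ℕ.≤ p′ → ∤ eps0 p r e
  ∤-eps0 r e rm≤p′ e≤p′ = ∤-* {sign ℤ.* factorial} (∤-* {sign} {factorial} (∤-sign n) (prime-∤-! isPrime (s≤s rm≤p′)))
    (∤-^ {+ (e !)} (prime-∤-! isPrime (s≤s e≤p′)) r)
    where
    n = ((suc r ℕ.* suc (suc r)) / 2) ℕ.+ ((r ℕ.* suc r) / 2) ℕ.* e
    sign = -1ℤ ℤ.^ n
    factorial = + ((r ℕ.* (p′ ∸ e)) !)

  -- The number r of points stays a variable, so that the operations of Ser r do not unfold.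
  module _ (r k e : ℕ) (k+2≡r : suc (suc k) ≡ r) (e≤p′ : e ℕ.≤ p′) (p′<2e : p′ ℕ.< 2 ℕ.* e) where
    private
      m g : ℕ
      m = p′ ∸ e
      g = 2 ℕ.* e ∸ p′
    open Ser r hiding (zero)
    open import Relation.Binary.Reasoning.Setoid setoid
    open Bridge p r
    open IntegerCoefficients (serRing r) (constS-homomorphism r)
    open Exp semiring using (_^_; ^-congˡ)
    open Polynomials (serRing r) (constS-homomorphism r) S
    open Determinants (serRing r) (constS-homomorphism r) S p′ (characteristic-p r)
    open Exponents (serRing r) (constS-homomorphism r) S p′ (characteristic-p r)
    open Top (- 1#) (factorial-inverse r) (sgn-p′ r)

    m+e≡p′ : m ℕ.+ e ≡ p′
    m+e≡p′ = ℕ.m∸n+n≡m e≤p′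

    e≡m+g : e ≡ m ℕ.+ g
    e≡m+g = ℕ.+-cancelˡ-≡ e e (m ℕ.+ g) (≡.trans (≡.cong (e ℕ.+_) (≡.sym (ℕ.+-identityʳ e)))
      (≡.trans (≡.sym (ℕ.m+[n∸m]≡n (ℕ.<⇒≤ p′<2e)))
        (≡.trans (≡.cong (ℕ._+ g) (≡.trans (≡.sym m+e≡p′) (ℕ.+-comm m e))) (ℕ.+-assoc e m g))))

    0<e : 1 ℕ.≤ e
    0<e = ℕ.n≢0⇒n>0 λ { ≡.refl → ℕ.<⇒≱ p′<2e z≤n }

    0<g : 1 ℕ.≤ g
    0<g = ℕ.m<n⇒0<n∸m p′<2e

    constS-eps0 : constS (eps0 p r e) ≈ sgn (tri (2 ℕ.+ r) ℕ.+ tri (suc r) ℕ.* e) * (ν ((r ℕ.* m) !) * ν (e !) ^ r)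
    constS-eps0 = begin
      constS (eps0 p r e)
        ≈⟨ trans (constS-* r _ _) (*-cong (constS-* r _ _) (constS-^ (+ (e !)) r)) ⟩
      constS (-1ℤ ℤ.^ n) * ν ((r ℕ.* m) !) * ν (e !) ^ r
        ≈⟨ trans (*-congʳ (*-congʳ (trans (constS-sgn n)
             (reflexive (≡.cong₂ (λ i j → sgn (i ℕ.+ j ℕ.* e)) (tri-/2 (suc r)) (tri-/2 r)))))) (*-assoc _ _ _) ⟩
      sgn (tri (2 ℕ.+ r) ℕ.+ tri (suc r) ℕ.* e) * (ν ((r ℕ.* m) !) * ν (e !) ^ r) ∎
      where
      n = ((suc r ℕ.* suc (suc r)) / 2) ℕ.+ ((r ℕ.* suc r) / 2) ℕ.* e

    2≤r : 2 ℕ.≤ r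
    2≤r = ≡.subst (2 ℕ.≤_) k+2≡r (s≤s (s≤s z≤n))

    N-zs : N (suc k) (E (at e (zs r))) ≈ constS (eps0 p r e) *S (delta r ^S g)
    N-zs = begin
      N (suc k) (E (at e (zs r)))
        ≈⟨ evaluate m e g k (zs r) m+e≡p′ e≡m+g (≡.trans (zs-length r) (≡.sym k+2≡r)) (factorials r m e m+e≡p′)
             (vandermonde-regular r r varS (RegularElements.varS-difference-regular p r)) ⟩
      constant (suc (suc k)) * vandermonde (zs r) ^ g
        ≡⟨ ≡.cong (λ i → constant i * vandermonde (zs r) ^ g) k+2≡r ⟩
      constant r * vandermonde (zs r) ^ g
        ≈⟨ *-cong (sym constS-eps0) (trans (^-congˡ g (sym (delta-vandermonde r))) (reflexive (≡.sym (^S-^ (delta r) g)))) ⟩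
      constS (eps0 p r e) *S (delta r ^S g) ∎
      where
      constant : ℕ → Carrier
      constant i = sgn (tri (2 ℕ.+ i) ℕ.+ tri (suc i) ℕ.* e) * (ν ((i ℕ.* m) !) * ν (e !) ^ i)

    signed : ∀ d n → d ℕ.≤ p → N d (E (at e (zs r))) ≈ sgn n * N (suc k) (E (at e (zs r))) →
             det d (Mmat p r e d) ≈ constS (-1ℤ ℤ.^ n ℤ.* eps0 p r e) *S (delta r ^S g)
    signed d n d≤p N≈ = begin
      det d (Mmat p r e d)                                      ≈⟨ det-Mmat r e d d≤p ⟩
      N d (E (at e (zs r)))                                     ≈⟨ N≈ ⟩
      sgn n * N (suc k) (E (at e (zs r)))                       ≈⟨ *-cong (sym (constS-sgn n)) N-zs ⟩
      constS (-1ℤ ℤ.^ n) * (constS (eps0 p r e) * (delta r ^S g))   ≈⟨ trans (sym (*-assoc _ _ _)) (*-congʳ (sym (constS-* r _ _))) ⟩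
      constS (-1ℤ ℤ.^ n ℤ.* eps0 p r e) *S (delta r ^S g) ∎

    witness0 : r ℕ.* m ℕ.≤ p′ → suc k ℕ.≤ p → AWitness p r e (suc k) (eps0 p r e) g
    witness0 rm≤p′ d≤p = 2≤r , 0<e , s≤s z≤n , d≤p , ∤-eps0 r e rm≤p′ e≤p′ , 0<g ,
      trans (det-Mmat r e (suc k) d≤p) N-zs

    -- For e = p-1 the degree of the polynomial is r(p-1), at which `peel` reduces size r to r-1
    -- with sign (-1)^{r-1}.
    witness+ : e ≡ p′ → suc (suc k) ℕ.≤ p → AWitness p r e (suc (suc k)) (-1ℤ ℤ.^ suc k ℤ.* eps0 p r e) g
    witness+ e≡p′ r≤p = 2≤r , 0<e , s≤s z≤n , r≤p ,
      ∤-* { -1ℤ ℤ.^ suc k} {eps0 p r e} (∤-sign (suc k)) (∤-eps0 r e rm≤p′ e≤p′) , 0<g ,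
      signed (suc (suc k)) (suc k) r≤p (peel (suc k)
        (≡.subst (λ n → Leading n 1# (E (at e (zs r)))) degree (Leading-E e (zs r))))
      where
      degree : length (zs r) ℕ.* e ≡ suc (suc k) ℕ.* p′
      degree = ≡.cong₂ ℕ._*_ (≡.trans (zs-length r) (≡.sym k+2≡r)) e≡p′
      rm≤p′ : r ℕ.* m ℕ.≤ p′
      rm≤p′ = ≡.subst (ℕ._≤ p′) (≡.sym (≡.trans (≡.cong (λ i → r ℕ.* (p′ ∸ i)) e≡p′)
        (≡.trans (≡.cong (r ℕ.*_) (ℕ.n∸n≡0 p′)) (ℕ.*-zeroʳ r)))) z≤n

    -- From rm = p-1 follows re = (r-1)(p-1), so `peel` applies at size r-1 and is read backwards.
    -- Its sign (-1)^{r-2} equals (-1)^r.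
    witness- : r ℕ.* m ≡ p′ → 1 ℕ.≤ k → AWitness p r e k (epsB- p r e) g
    witness- rm≡p′ 0<k = 2≤r , 0<e , 0<k , k≤p ,
      ∤-* { -1ℤ ℤ.^ r} {eps0 p r e} (∤-sign r) (∤-eps0 r e (ℕ.≤-reflexive rm≡p′) e≤p′) , 0<g ,
      signed k r k≤p (begin
        N k F                                ≈⟨ trans (*-congʳ sgn²) (*-identityˡ _) ⟨
        sgn r * sgn k * N k F                ≈⟨ trans (*-assoc _ _ _) (*-congˡ (sym (peel k leading))) ⟩
        sgn r * N (suc k) F ∎)
      where
      F = E (at e (zs r))
      sgn² : sgn r * sgn k ≈ 1#
      sgn² = trans (*-congʳ (reflexive (≡.cong sgn (≡.sym k+2≡r))))
        (trans (solve 1 (λ x → (:- (:- x)) :* x := x :* x) refl (sgn k)) (trans (sym (sgn-+ k k)) (sgn-even k)))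
      degree : r ℕ.* e ≡ suc k ℕ.* p′
      degree = ℕ.+-cancelˡ-≡ p′ (r ℕ.* e) (suc k ℕ.* p′) (≡.trans (≡.cong (ℕ._+ r ℕ.* e) (≡.sym rm≡p′))
        (≡.trans (≡.sym (ℕ.*-distribˡ-+ r m e)) (≡.trans (≡.cong (r ℕ.*_) m+e≡p′) (≡.cong (ℕ._* p′) (≡.sym k+2≡r)))))
      leading : Leading (suc k ℕ.* p′) 1# F
      leading = ≡.subst (λ n → Leading n 1# F)
        (≡.trans (≡.cong (ℕ._* e) (zs-length r)) degree) (Leading-E e (zs r))
      m≢0 : ¬ m ≡ 0
      m≢0 m≡0 = ℕ.1+n≢0 (≡.trans (≡.sym rm≡p′) (≡.trans (≡.cong (r ℕ.*_) m≡0) (ℕ.*-zeroʳ r)))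
      k≤p : k ℕ.≤ p
      k≤p = ℕ.≤-trans (≡.subst (k ℕ.≤_) k+2≡r (ℕ.m≤n+m k 2))
        (ℕ.≤-trans (ℕ.m≤m*n r m {{ℕ.≢-nonZero m≢0}}) (ℕ.≤-trans (ℕ.≤-reflexive rm≡p′) (ℕ.n≤1+n p′)))

  -- This rules out d = 0 in the last family: r = 2 would force e = (p-1)/2, against the strict
  -- inequality.
  two-points : ∀ e → e ℕ.≤ p′ → p′ ℕ.< 2 ℕ.* e → ¬ 2 ℕ.* (p′ ∸ e) ≡ p′
  two-points e e≤p′ p′<2e 2m≡p′ = ℕ.<-irrefl ≡.refl (ℕ.<-≤-trans m<e (ℕ.≤-reflexive (≡.sym m≡e)))
    where
    m = p′ ∸ e
    m≡e : m ≡ e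
    m≡e = ℕ.+-cancelˡ-≡ m m e (≡.trans (≡.trans (≡.cong (m ℕ.+_) (≡.sym (ℕ.+-identityʳ m))) 2m≡p′) (≡.sym (ℕ.m∸n+n≡m e≤p′)))
    m<e : m ℕ.< e
    m<e = ℕ.*-cancelˡ-< 2 m e (≡.subst (ℕ._< 2 ℕ.* e) (≡.sym 2m≡p′) p′<2e)

  inB+ : ∀ r e d → InB+ p r e d → AWitness p r e d (epsB+ p r e) (gExp p e)
  inB+ r e d (2≤r , r≤p , ≡.refl , ≡.refl) =
    ≡.subst (λ i → AWitness p r p′ i (-1ℤ ℤ.^ (i ∸ 1) ℤ.* eps0 p r p′) (gExp p p′)) r≡
      (witness+ r (r ∸ 2) p′ r≡ ℕ.≤-refl (ℕ.m<m+n p′ (s≤s z≤n)) ≡.refl (≡.subst (ℕ._≤ p) (≡.sym r≡) r≤p))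
    where
    r≡ : suc (suc (r ∸ 2)) ≡ r
    r≡ = ℕ.m+[n∸m]≡n 2≤r

  inB0 : ∀ r e d → InB0 p r e d → AWitness p r e d (eps0 p r e) (gExp p e)
  inB0 r e d (2≤r , r≤p+1 , p′<2e , e≤p′ , rm≤p′ , d+1≡r) =
    ≡.subst (λ i → AWitness p r e i (eps0 p r e) (gExp p e)) d≡
      -- Since d = r-1, the bound r ≤ p+1 is the required d ≤ p.
      (witness0 r (r ∸ 2) e r≡ e≤p′ p′<2e rm≤p′ (ℕ.s≤s⁻¹ (≡.subst (ℕ._≤ suc p) (≡.sym r≡) r≤p+1)))
    where
    r≡ : suc (suc (r ∸ 2)) ≡ r
    r≡ = ℕ.m+[n∸m]≡n 2≤r
    d≡ : suc (r ∸ 2) ≡ d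
    d≡ = ℕ.suc-injective (≡.trans r≡ (≡.sym d+1≡r))

  inB- : ∀ r e d → InB- p r e d → AWitness p r e d (epsB- p r e) (gExp p e)
  inB- r e d (2≤r , p′<2e , e≤p′ , rm≡p′ , d+2≡r) =
    witness- r d e r≡ e≤p′ p′<2e rm≡p′ (ℕ.n≢0⇒n>0 0<d)
    where
    r≡ : suc (suc d) ≡ r
    r≡ = ≡.trans (ℕ.+-comm 2 d) d+2≡r
    0<d : ¬ d ≡ 0
    0<d d≡0 = two-points e e≤p′ p′<2e (≡.trans (≡.cong (λ i → i ℕ.* (p′ ∸ e)) (≡.trans (≡.cong (2 ℕ.+_) (≡.sym d≡0)) r≡)) rm≡p′)

theorem1 : (p : ℕ) → Prime p →
    ((r e d : ℕ) → InB p r e d → InA p r e d)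
    × ((r e d : ℕ) → InB+ p r e d → AWitness p r e d (epsB+ p r e) (gExp p e))
    × ((r e d : ℕ) → InB0 p r e d → AWitness p r e d (eps0 p r e) (gExp p e))
    × ((r e d : ℕ) → InB- p r e d → AWitness p r e d (epsB- p r e) (gExp p e))
theorem1 p isPrime with ℕ.nonTrivial⇒n>1 p {{prime⇒nonTrivial isPrime}}
theorem1 (suc (suc q)) isPrime | s≤s (s≤s z≤n) =
  (λ { r e d (inj₁ b)        → _ , _ , inB+ r e d b
     ; r e d (inj₂ (inj₁ b)) → _ , _ , inB0 r e d b
     ; r e d (inj₂ (inj₂ b)) → _ , _ , inB- r e d b })
  , inB+ , inB0 , inB-
  where open Evaluation q isPrime
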